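{- Let $w\in S_n$, and fix any term order on monomials in $x_1,\ldots,x_n$ satisfying $x_1<x_2<\cdots<x_n$. For each integer $d$ with $1\le d\le \mathrm{raj}(w)-\mathrm{inv}(w)$, $$\mathbf{x}^{\overline{L}_w(d)}=\min\left\{\mathbf{x}^{\overline{\mathrm{wt}}(C,U)}\ \middle|\ (C,U)\text{ is a marked climbing chain of }w\text{ with }\#U=\ell(C)-d\right\}.$$ Equivalently, $$\mathbf{x}^{L_w(d)}=\max\left\{\mathbf{x}^{\mathrm{wt}(C,U)}\ \middle|\ (C,U)\text{ is a marked climbing chain of }w\text{ with }\#U=\ell(C)-d\right\}.$$ Here min and max are taken with respect to the term order.
   Context: Conventions. Permutations are in one-line notation; $t_{ij}$ is the transposition of $i,j$, and $wt_{ij}$ is $w$ with the values in positions $i$ and $j$ exchanged. $w_0\in S_n$ is the longest permutation, $w_0(k)=n+1-k$. The Bruhat order is the transitive closure of $w\le wt_{ij}$ for $i<j$ with $w(i)<w(j)$; $\lessdot$ denotes its cover relation. $e_1,\dots,e_n$ is the standard basis of $\mathbb{Z}^n$, $|v|=\sum_k v_k$, $\mathbf{x}^v=\prod_k x_k^{v_k}$, and $[n]=\{1,\ldots,n\}$. Climbing chains. A climbing chain of $w\in S_n$ is a sequence $C=(C_1,\ldots,C_m)$ of pairs (links) $C_p=(i_p,j_p)$ with $i_p<j_p$, $i_1\le\cdots\le i_m$, $wt_{i_1j_1}\cdots t_{i_mj_m}=w_0$, and $wt_{i_1j_1}\cdots t_{i_{p-1}j_{p-1}}\lessdot wt_{i_1j_1}\cdots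 t_{i_pj_p}$ for each $p\in[m]$; $\ell(C)=m$. (The only climbing chain of $w_0$ is empty. The links of a chain are distinct, so $C$ is also regarded as a set.) The set of minimal markings is $M(C)=\{C_p\mid i_{p-1}<i_p,\text{ or } i_{p-1}=i_p\text{ and }j_{p-1}<j_p\}$ with $i_0=0$. A marked climbing chain is a pair $(C,U)$ with $M(C)\subseteq U\subseteq C$. Its dual weight $\overline{\mathrm{wt}}(C,U)\in\mathbb{Z}^n$ has $k$th entry the number of links of the form $(k,\star)$ in $U$; its weight has $\mathrm{wt}(C,U)_k=n-k-\overline{\mathrm{wt}}(C,U)_k$. Codes. $\mathrm{invcode}(w)_i=\#\{j>i\mid w(j)<w(i)\}$ and $\mathrm{inv}(w)=|\mathrm{invcode}(w)|$. $\overline{\mathrm{rajcode}}(w)_i$ is the maximal number $m$ of positions in a sequence $i=\alpha_1<\cdots<\alpha_m\le n$ with $w(\alpha_1)<\cdots<w(\alpha_m)$, minus one. $\mathrm{rajcode}(w)_k=n-k-\overline{\mathrm{rajcode}}(w)_k$, and $\mathrm{raj}(w)=|\mathrm{rajcode}(w)|$. One has $\mathrm{rajcode}(w)_k\ge\mathrm{invcode}(w)_k$ for all $k$. The vectors $L_w$. Let $D=\mathrm{raj}(w)-\mathrm{inv}(w)$. Set $L_w(0)=\mathrm{invcode}(w)$; for $1\le i\le D$ let $j\in[n]$ be the largest index with $L_w(i-1)_j<\mathrm{rajcode}(w)_j$ and set $L_w(i)=L_w(i-1)+e_j$. Finally $\overline{L}_w(i)_k=n-k-L_w(i)_k$. 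-}

module Defs where

open import Level using (Level; _⊔_) renaming (suc to lsuc)
open import Data.Bool.Base using (if_then_else_)
open import Data.Nat.Base using (ℕ; zero; suc; _+_; _∸_; pred)
import Data.Nat.Properties as ℕₚ
open import Data.Fin.Base using (Fin; toℕ; _<_; _≤_)
open import Data.Fin.Properties using (_≟_; _<?_)
open import Data.Fin.Permutation using (Permutation′; _⟨$⟩ʳ_; _≈_; _∘ₚ_; transpose; reverse)
open import Data.Fin.Subset using (Subset; inside; _⊆_; ∣_∣) renaming (_∈_ to _∈ˢ_)
open import Data.Fin.Subset.Properties using (_∈?_)
open import Data.List.Base using (List; []; _∷_; _++_; map; filter; length; lookup; allFin; head; last; foldl)
open import Data.List.Extrema.Nat using (max)
open import Data.List.Relation.Unary.All using (All)
open import Data.List.Relation.Unary.Linked using (Linked; linked?)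
open import Data.Maybe.Base using (just; maybe)
import Data.Maybe.Properties as Maybeₚ
open import Data.Product.Base using (_×_; _,_; proj₁; ∃; uncurry′)
open import Data.Sum.Base using (_⊎_)
open import Data.Unit.Base using (⊤)
import Data.Vec.Base as Vec
open import Data.Vec.Functional using (Vector)
open import Algebra.Properties.Monoid.Sum ℕₚ.+-0-monoid using (sum)
open import Function.Base using (flip)
open import Relation.Binary.Core using (Rel)
open import Relation.Binary.Structures using (IsTotalOrder)
open import Relation.Binary.Construct.Closure.Transitive using (TransClosure)
import Relation.Binary.Construct.NonStrictToStrict as ToStrict
open import Relation.Binary.PropositionalEquality.Core using (_≡_; _≗_)
open import Relation.Nullary.Decidable using (does; _×-dec_; _⊎-dec_)
open import Relation.Nullary.Negation using (¬_)
open import Relation.Unary using (Pred; Decidable; _∈_)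

private
  variable
    a ℓ ℓ′ : Level
    n : ℕ

-- Positions and values 1, …, n are represented by Fin n, so the position
-- written k on paper is the k : Fin n with suc (toℕ k) equal to it.

#[_] : {P : Pred (Fin n) ℓ} → Decidable P → ℕ
#[_] {n} P? = length (filter P? (allFin n))

-- The monomial 𝐱^v is represented by its exponent vector v, and equality
-- of monomials by _≗_.

𝐞 : Fin n → Vector ℕ n
𝐞 j k = if does (j ≟ k) then 1 else 0

infixl 6 _⊕_

_⊕_ : Vector ℕ n → Vector ℕ n → Vector ℕ n
(u ⊕ v) k = u k + v k

𝟎 : Vector ℕ n
𝟎 _ = 0

-- k ↦ n − k − v_k.  It is only applied to vectors with v_k ≤ n − k, for
-- which the truncated subtraction is exact.

complement : Vector ℕ n → Vector ℕ n
complement {n} v k = (n ∸ suc (toℕ k)) ∸ v k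

record TermOrder (n : ℕ) (ℓ : Level) : Set (lsuc ℓ) where
  infix 4 _≼_ _≺_
  field
    _≼_          : Rel (Vector ℕ n) ℓ
    isTotalOrder : IsTotalOrder _≗_ _≼_
    ⊕-monoˡ      : ∀ t {u v} → u ≼ v → u ⊕ t ≼ v ⊕ t
    𝟎-minimum    : ∀ v → 𝟎 ≼ v

  _≺_ : Rel (Vector ℕ n) ℓ
  _≺_ = ToStrict._<_ _≗_ _≼_

IsMaximum : {A : Set a} → Rel A ℓ → Pred A ℓ′ → A → Set (a ⊔ ℓ ⊔ ℓ′)
IsMaximum _≤′_ S v = v ∈ S × (∀ u → u ∈ S → u ≤′ v)

IsMinimum : {A : Set a} → Rel A ℓ → Pred A ℓ′ → A → Set (a ⊔ ℓ ⊔ ℓ′)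
IsMinimum _≤′_ = IsMaximum (flip _≤′_)

-- w t_{ij}: _∘ₚ_ applies its left argument first, so positions are swapped.

swapAt : Permutation′ n → Fin n → Fin n → Permutation′ n
swapAt w i j = transpose i j ∘ₚ w

infix 4 _⟶_ _≤ᴮ_ _<ᴮ_ _⋖_

_⟶_ : Rel (Permutation′ n) _
w ⟶ v = ∃ λ i → ∃ λ j → i < j × w ⟨$⟩ʳ i < w ⟨$⟩ʳ j × v ≈ swapAt w i j

_≤ᴮ_ : Rel (Permutation′ n) _
w ≤ᴮ v = w ≈ v ⊎ TransClosure _⟶_ w v

_<ᴮ_ : Rel (Permutation′ n) _
_<ᴮ_ = ToStrict._<_ _≈_ _≤ᴮ_

_⋖_ : Rel (Permutation′ n) _
w ⋖ v = w <ᴮ v × (∀ u → ¬ (w <ᴮ u × u <ᴮ v))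

Link : ℕ → Set
Link n = Fin n × Fin n

infixl 7 _▷_

_▷_ : Permutation′ n → List (Link n) → Permutation′ n
_▷_ = foldl (λ w → uncurry′ (swapAt w))

Saturated : Permutation′ n → List (Link n) → Set
Saturated w []            = ⊤
Saturated w ((i , j) ∷ C) = w ⋖ swapAt w i j × Saturated (swapAt w i j) C

record IsClimbingChain (w : Permutation′ n) (C : List (Link n)) : Set where
  field
    ordered   : All (uncurry′ _<_) C
    monotone  : Linked (λ c c′ → proj₁ c ≤ proj₁ c′) C
    endsAtTop : w ▷ C ≈ reverse
    saturated : Saturated w C

-- The links of a climbing chain are distinct, so sets of links are
-- represented by sets of indices into the chain.

minimalAfter : Link n → (C : List (Link n)) → Subset (length C)
minimalAfter _       []              = Vec.[]
minimalAfter (i , j) ((i′ , j′) ∷ C) =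
  does (i <? i′ ⊎-dec (i ≟ i′ ×-dec j <? j′)) Vec.∷ minimalAfter (i′ , j′) C

-- The first link always belongs to M(C), since i₀ = 0 < i₁.

minimalMarkings : (C : List (Link n)) → Subset (length C)
minimalMarkings []      = Vec.[]
minimalMarkings (c ∷ C) = inside Vec.∷ minimalAfter c C

record MarkedClimbingChain (w : Permutation′ n) : Set where
  field
    links           : List (Link n)
    isClimbingChain : IsClimbingChain w links
    marks           : Subset (length links)
    minimal⊆marks   : minimalMarkings links ⊆ marks

  chainLength : ℕ
  chainLength = length links

  #marks : ℕ
  #marks = ∣ marks ∣

  dualWeight : Vector ℕ n
  dualWeight k = #[ (λ p → p ∈? marks ×-dec proj₁ (lookup links p) ≟ k) ]

  weight : Vector ℕ n
  weight = complement dualWeight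

-- #U = ℓ(C) − d is written additively, to avoid truncated subtraction.

module _ (w : Permutation′ n) (d : ℕ) where
  open MarkedClimbingChain

  DualWeights : Pred (Vector ℕ n) _
  DualWeights v = ∃ λ (K : MarkedClimbingChain w) →
    #marks K + d ≡ chainLength K × dualWeight K ≗ v

  Weights : Pred (Vector ℕ n) _
  Weights v = ∃ λ (K : MarkedClimbingChain w) →
    #marks K + d ≡ chainLength K × weight K ≗ v

invcode : Permutation′ n → Vector ℕ n
invcode w i = #[ (λ j → i <? j ×-dec w ⟨$⟩ʳ j <? w ⟨$⟩ʳ i) ]

inv : Permutation′ n → ℕ
inv w = sum (invcode w)

subsequences : {A : Set a} → List A → List (List A)
subsequences []       = [] ∷ []
subsequences (x ∷ xs) = map (x ∷_) (subsequences xs) ++ subsequences xs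

IncreasingFrom : Permutation′ n → Fin n → Pred (List (Fin n)) _
IncreasingFrom w i α =
  head α ≡ just i × Linked (λ p q → p < q × w ⟨$⟩ʳ p < w ⟨$⟩ʳ q) α

increasingFrom? : (w : Permutation′ n) (i : Fin n) → Decidable (IncreasingFrom w i)
increasingFrom? w i α =
  Maybeₚ.≡-dec _≟_ (head α) (just i) ×-dec
  linked? (λ p q → p <? q ×-dec w ⟨$⟩ʳ p <? w ⟨$⟩ʳ q) α

-- Every strictly increasing sequence of positions is a subsequence of
-- allFin n, and the one-term sequence i always qualifies, so the maximum is
-- at least 1 and neither the base value 0 nor the truncation of pred matters.

rajcodeᵈ : Permutation′ n → Vector ℕ n
rajcodeᵈ {n} w i =
  pred (max 0 (map length (filter (increasingFrom? w i) (subsequences (allFin n)))))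

rajcode : Permutation′ n → Vector ℕ n
rajcode w = complement (rajcodeᵈ w)

raj : Permutation′ n → ℕ
raj w = sum (rajcode w)

-- As rajcode dominates invcode, an index to increment exists as long as
-- i < raj w ∸ inv w; from then on the sequence is constant.

L : Permutation′ n → ℕ → Vector ℕ n
L         w zero    = invcode w
L {n = n} w (suc i) =
  maybe (λ j → L w i ⊕ 𝐞 j) (L w i)
        (last (filter (λ j → L w i j ℕₚ.<? rajcode w j) (allFin n)))

Lᵈ : Permutation′ n → ℕ → Vector ℕ n
Lᵈ w i = complement (L w i)

{-# OPTIONS --safe #-}
module Submission where

-- Every term order with x₁ < … < xₙ refines the order in which u lies below v when
-- |u| = |v| and every final segment of u has sum at most that of v.  So it suffices
-- that L̄_w(d) is attained and lies below every dual weight of degree ℓ(C) − d in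
-- this sense.  Write c for the dual inversion code (k ↦ #{l > k : w(l) > w(k)}) and
-- r for the dual rajcode; L̄_w(d) agrees with c, then takes one intermediate value,
-- then agrees with r.
--
-- Lower bound.  A link (i, j) lowers every initial sum of c beyond i by at least
-- one, so the initial sums of a dual weight are at most those of c.  Its final sums
-- are at least those of r: along the links (i, ∗), the sum of r, with the entry of i
-- measured from the position of the last link, drops by at most one per marked link
-- and not at all at an unmarked one.
--
-- Attainment.  In row i always jump to the least larger value, marking every link;
-- this realises c.  To realise r instead, jump to the least value that can follow
-- w(i) on a longest increasing subsequence: then the positions of the links decrease
-- as long as the length of that subsequence does not drop.  Neither choice changes
-- r outside row i, and in the intermediate row one changes from the first rule to
-- the second.

open import Defs
open import Level using (Level)
open import Data.Bool.Base using (true; false; if_then_else_)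
open import Data.Nat.Base as ℕ using (ℕ; zero; suc; _+_; _*_; _≤_; _∸_; z≤n; s≤s)
import Data.Nat.Properties as ℕₚ
open import Data.Fin.Base as Fin using (Fin; zero; suc; toℕ; opposite; _<_)
import Data.Fin.Properties as Finₚ
open Finₚ using (_≟_; _<?_)
open import Data.Fin.Permutation using (Permutation′; _⟨$⟩ʳ_; _≈_; transpose; reverse)
import Data.Fin.Permutation.Components as PC
open import Data.Fin.Subset using (Subset; inside; outside; _⊆_; ∣_∣) renaming (_∈_ to _∈ˢ_)
open import Data.Fin.Subset.Properties using (_∈?_; drop-∷-⊆)
open import Data.List.Base using (List; []; _∷_; map; filter; length; allFin; tabulate; last; lookup)
open import Data.List.Extrema.Nat
  using (argmin; argmax; v≤max⁺; argmax-sel; argmin-all; argmax-all; f[argmin]≤f[xs]; f[xs]≤f[argmax])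
open import Data.List.Membership.Propositional using (_∈_; lose)
open import Data.List.Membership.Propositional.Properties
  using (∈-allFin; ∈-filter⁺; ∈-filter⁻; ∈-map⁺; ∈-map⁻; ∈-++⁺ˡ; ∈-++⁺ʳ)
open import Data.List.Relation.Unary.All as All using (All; []; _∷_)
open import Data.List.Relation.Unary.All.Properties using (all-filter)
open import Data.List.Relation.Unary.AllPairs using (AllPairs; []; _∷_)
import Data.List.Relation.Unary.AllPairs.Properties as AllPairsₚ
open import Data.List.Relation.Unary.Any using (here; there)
open import Data.List.Relation.Unary.Linked as Linked using (Linked; []; [-]; _∷_)
import Data.List.Relation.Unary.Linked.Properties as Linkedₚ
open import Data.Maybe.Base using (Maybe; just; nothing; maybe)
open import Data.Product.Base using (_×_; _,_; proj₁; proj₂; ∃; uncurry′)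
open import Data.Sum.Base using (_⊎_; inj₁; inj₂; [_,_]′)
open import Data.Unit.Base using (⊤; tt)
import Data.Vec.Base as Vec
open Vec using (here; there)
open import Data.Vec.Functional as Vector using (Vector)
open import Algebra.Properties.CommutativeMonoid.Sum ℕₚ.+-0-commutativeMonoid
  using (sum; sum-cong-≗; sum-replicate-zero; sum-permute; ∑-distrib-+)
open import Function.Base using (_∘_; const; id)
open import Function.Bundles using (module Injection)
open import Function.Properties.Inverse using (↔⇒↣)
open import Relation.Binary.Construct.Closure.Transitive using (TransClosure; [_]; _∷_)
open import Relation.Binary.Core using (Rel)
open import Relation.Binary.Definitions using (tri<; tri≈; tri>)
open import Relation.Binary.PropositionalEquality
  using (_≡_; _≢_; _≗_; refl; sym; trans; cong; cong₂; subst; subst₂; ≢-sym; module ≡-Reasoning)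
open import Relation.Binary.Structures using (IsTotalOrder)
open import Relation.Nullary using (¬_; Dec; does; yes; no; contradiction)
open import Relation.Nullary.Decidable using (dec-true; dec-false; ¬?; _×-dec_; _⊎-dec_)
open import Relation.Unary using (Pred; Decidable)

private
  variable
    ℓ ℓ₁ ℓ₂ : Level
    n : ℕ

-- Sums and counting

infixl 8 _↾_

_↾_ : Vector ℕ n → {P : Pred (Fin n) ℓ} → Decidable P → Vector ℕ n
(v ↾ P?) k = if does (P? k) then v k else 0

↾-in : ∀ {n} {P : Pred (Fin n) ℓ} (P? : Decidable P) v k → P k → (v ↾ P?) k ≡ v k
↾-in P? v k p rewrite dec-true (P? k) p = refl

↾-out : ∀ {P : Pred (Fin n) ℓ} (P? : Decidable P) v k → ¬ P k → (v ↾ P?) k ≡ 0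
↾-out P? v k ¬p rewrite dec-false (P? k) ¬p = refl

↾-⊕ : ∀ {P : Pred (Fin n) ℓ} (P? : Decidable P) u v → (u ⊕ v) ↾ P? ≗ u ↾ P? ⊕ v ↾ P?
↾-⊕ P? u v k with does (P? k)
... | true  = refl
... | false = refl

↾-mono : ∀ {P : Pred (Fin n) ℓ} (P? : Decidable P) {u v} →
         (∀ {k} → P k → u k ≤ v k) → ∀ k → (u ↾ P?) k ≤ (v ↾ P?) k
↾-mono P? u≤v k with P? k
... | yes p = u≤v p
... | no  _ = z≤n

↾-≤ : ∀ {P : Pred (Fin n) ℓ} (P? : Decidable P) v k → (v ↾ P?) k ≤ v k
↾-≤ P? v k with does (P? k)
... | true  = ℕₚ.≤-refl
... | false = z≤n

sum-mono : ∀ {n} {u v : Vector ℕ n} → (∀ k → u k ≤ v k) → sum u ≤ sum v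
sum-mono {n = zero}  u≤v = z≤n
sum-mono {n = suc n} u≤v = ℕₚ.+-mono-≤ (u≤v zero) (sum-mono (u≤v ∘ suc))

sum-zero : ∀ {n} {u : Vector ℕ n} → u ≗ 𝟎 → sum u ≡ 0
sum-zero {n = n} u≗0 = trans (sum-cong-≗ u≗0) (sum-replicate-zero n)

sum-point : ∀ (i : Fin n) m → sum (const m ↾ (i ≟_)) ≡ m
sum-point {suc n} zero    m =
  trans (cong (m +_) (sum-zero {n} λ k → ↾-out (zero ≟_) (const m) (suc k) λ ())) (ℕₚ.+-identityʳ m)
sum-point {suc n} (suc i) m = sum-point i m

sum-off : ∀ v (i : Fin n) → sum v ≡ sum (v ↾ (¬? ∘ (i ≟_))) + v i
sum-off v i = begin
  sum v                                     ≡⟨ sum-cong-≗ split ⟩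
  sum (v ↾ (¬? ∘ (i ≟_)) ⊕ const (v i) ↾ (i ≟_))
    ≡⟨ ∑-distrib-+ (v ↾ (¬? ∘ (i ≟_))) _ ⟩
  sum (v ↾ (¬? ∘ (i ≟_))) + sum (const (v i) ↾ (i ≟_))
    ≡⟨ cong (sum (v ↾ (¬? ∘ (i ≟_))) +_) (sum-point i (v i)) ⟩
  sum (v ↾ (¬? ∘ (i ≟_))) + v i ∎
  where
  open ≡-Reasoning
  split : v ≗ v ↾ (¬? ∘ (i ≟_)) ⊕ const (v i) ↾ (i ≟_)
  split k with i ≟ k
  ... | yes refl = refl
  ... | no  _    = sym (ℕₚ.+-identityʳ (v k))

sum-split : ∀ {P : Pred (Fin n) ℓ} (P? : Decidable P) v →
            sum v ≡ sum (v ↾ P?) + sum (v ↾ (¬? ∘ P?))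
sum-split P? v = trans (sum-cong-≗ split) (∑-distrib-+ (v ↾ P?) _)
  where
  split : v ≗ v ↾ P? ⊕ v ↾ (¬? ∘ P?)
  split k with P? k
  ... | yes _ = sym (ℕₚ.+-identityʳ (v k))
  ... | no  _ = refl

#-tabulate : ∀ {a} {A : Set a} {P : Pred A ℓ} (P? : Decidable P) (f : Fin n → A) →
             length (filter P? (tabulate f)) ≡ sum (const 1 ↾ (P? ∘ f))
#-tabulate {n = zero}  P? f = refl
#-tabulate {n = suc n} P? f with does (P? (f zero))
... | true  = cong suc (#-tabulate P? (f ∘ suc))
... | false = #-tabulate P? (f ∘ suc)

#-sum : ∀ {P : Pred (Fin n) ℓ} (P? : Decidable P) → #[ P? ] ≡ sum (const 1 ↾ P?)
#-sum P? = #-tabulate P? id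

#-mono : ∀ {P : Pred (Fin n) ℓ₁} {Q : Pred (Fin n) ℓ₂} (P? : Decidable P) (Q? : Decidable Q) →
         (∀ {k} → P k → Q k) → #[ P? ] ≤ #[ Q? ]
#-mono P? Q? P⊆Q rewrite #-sum P? | #-sum Q? = sum-mono pointwise
  where
  pointwise : ∀ k → (const 1 ↾ P?) k ≤ (const 1 ↾ Q?) k
  pointwise k with P? k
  ... | yes p = ℕₚ.≤-reflexive (sym (↾-in Q? (const 1) k (P⊆Q p)))
  ... | no  _ = z≤n

#-cong : ∀ {P : Pred (Fin n) ℓ₁} {Q : Pred (Fin n) ℓ₂} (P? : Decidable P) (Q? : Decidable Q) →
         (∀ {k} → P k → Q k) → (∀ {k} → Q k → P k) → #[ P? ] ≡ #[ Q? ]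
#-cong P? Q? P⊆Q Q⊆P = ℕₚ.≤-antisym (#-mono P? Q? P⊆Q) (#-mono Q? P? Q⊆P)

#-⊎ : ∀ {P : Pred (Fin n) ℓ} {Q : Pred (Fin n) ℓ₁} {R : Pred (Fin n) ℓ₂}
      (P? : Decidable P) (Q? : Decidable Q) (R? : Decidable R) →
      (∀ {k} → P k → Q k ⊎ R k) → (∀ {k} → Q k → P k) → (∀ {k} → R k → P k) →
      (∀ {k} → Q k → ¬ R k) → #[ P? ] ≡ #[ Q? ] + #[ R? ]
#-⊎ P? Q? R? P⊆ Q⊆ R⊆ disjoint rewrite #-sum P? | #-sum Q? | #-sum R? =
  trans (sum-cong-≗ pointwise) (∑-distrib-+ (const 1 ↾ Q?) _)
  where
  pointwise : const 1 ↾ P? ≗ const 1 ↾ Q? ⊕ const 1 ↾ R?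
  pointwise k with Q? k
  pointwise k | yes q = trans (↾-in P? (const 1) k (Q⊆ q))
    (cong suc (sym (↾-out R? (const 1) k (disjoint q))))
  pointwise k | no ¬q with R? k
  ... | yes r = ↾-in P? (const 1) k (R⊆ r)
  ... | no ¬r = ↾-out P? (const 1) k ([ ¬q , ¬r ]′ ∘ P⊆)

#-single : ∀ (i : Fin n) → #[ i ≟_ ] ≡ 1
#-single i = trans (#-sum (i ≟_)) (sum-point i 1)

#-permute : ∀ {P : Pred (Fin n) ℓ} (P? : Decidable P) (π : Permutation′ n) →
            #[ P? ] ≡ #[ (P? ∘ (π ⟨$⟩ʳ_)) ]
#-permute P? π = trans (#-sum P?) (trans (sum-permute _ π) (sym (#-sum (P? ∘ (π ⟨$⟩ʳ_)))))

#-empty : ∀ {P : Pred (Fin n) ℓ} (P? : Decidable P) → (∀ {k} → ¬ P k) → #[ P? ] ≡ 0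
#-empty P? ¬P = trans (#-sum P?) (sum-zero λ k → ↾-out P? (const 1) k ¬P)

#-positive : ∀ {P : Pred (Fin n) ℓ} (P? : Decidable P) {k} → P k → 1 ≤ #[ P? ]
#-positive P? {k} p = subst (_≤ #[ P? ]) (#-single k) (#-mono (k ≟_) P? λ { refl → p })

later? : ∀ (k : Fin n) → Decidable {A = Fin n} (k <_)
later? k l = k <? l

#-later : ∀ (k : Fin n) → #[ later? k ] ≡ n ∸ suc (toℕ k)
#-later {n} k = trans (#-sum (later? k)) (go k)
  where
  ones : ∀ n → sum {n} (const 1) ≡ n
  ones zero    = refl
  ones (suc n) = cong suc (ones n)
  go : ∀ {n} (k : Fin n) → sum (const 1 ↾ later? k) ≡ n ∸ suc (toℕ k)
  go {suc n} zero    = ones n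
  go {suc n} (suc k) = go k

-- Permutations and transpositions

val : Permutation′ n → Fin n → ℕ
val w k = toℕ (w ⟨$⟩ʳ k)

val-injective : ∀ (w : Permutation′ n) {k l} → val w k ≡ val w l → k ≡ l
val-injective w eq = Injection.injective (↔⇒↣ w) (Finₚ.toℕ-injective eq)

transpose-left : ∀ (i j : Fin n) → PC.transpose i j i ≡ j
transpose-left i j rewrite dec-true (i ≟ i) refl = refl

transpose-right : ∀ (i j : Fin n) → PC.transpose i j j ≡ i
transpose-right i j with j ≟ i
... | yes j≡i = j≡i
... | no  _ rewrite dec-true (j ≟ j) refl = refl

transpose-other : ∀ {i j k : Fin n} → k ≢ i → k ≢ j → PC.transpose i j k ≡ k
transpose-other {i = i} {j} {k} k≢i k≢j
  rewrite dec-false (k ≟ i) k≢i | dec-false (k ≟ j) k≢j = refl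

data Position {n} (i j : Fin n) : Fin n → Set where
  left  : Position i j i
  right : Position i j j
  other : ∀ {k} → k ≢ i → k ≢ j → Position i j k

position : ∀ (i j k : Fin n) → Position i j k
position i j k with k ≟ i | k ≟ j
... | yes refl | _        = left
... | no _     | yes refl = right
... | no k≢i   | no k≢j   = other k≢i k≢j

module _ (w : Permutation′ n) (i j : Fin n) where

  val-left : val (swapAt w i j) i ≡ val w j
  val-left = cong (val w) (transpose-left i j)

  val-right : val (swapAt w i j) j ≡ val w i
  val-right = cong (val w) (transpose-right i j)

  val-other : ∀ {k} → k ≢ i → k ≢ j → val (swapAt w i j) k ≡ val w k
  val-other k≢i k≢j = cong (val w) (transpose-other k≢i k≢j)

<⇒≢ : ∀ {k l : Fin n} → k < l → k ≢ l
<⇒≢ k<l refl = ℕₚ.<-irrefl refl k<l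

>⇒≢ : ∀ {k l : Fin n} → l < k → k ≢ l
>⇒≢ l<k refl = ℕₚ.<-irrefl refl l<k

≢⇒<⊎> : ∀ {k l : Fin n} → k ≢ l → k < l ⊎ l < k
≢⇒<⊎> {k = k} {l} k≢l with Finₚ.<-cmp k l
... | tri< k<l _ _   = inj₁ k<l
... | tri≈ _   k≡l _ = contradiction k≡l k≢l
... | tri> _   _ l<k = inj₂ l<k

val-<⊎> : ∀ (w : Permutation′ n) {k l} → k ≢ l → val w k ℕ.< val w l ⊎ val w l ℕ.< val w k
val-<⊎> w {k} {l} k≢l with ℕₚ.<-cmp (val w k) (val w l)
... | tri< k<l _ _   = inj₁ k<l
... | tri≈ _   k≡l _ = contradiction (val-injective w k≡l) k≢l
... | tri> _   _ l<k = inj₂ l<k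

val-≮ : ∀ (w : Permutation′ n) {k l} → k ≢ l → ¬ (val w k ℕ.< val w l) → val w l ℕ.< val w k
val-≮ w k≢l k≮l with val-<⊎> w k≢l
... | inj₁ k<l = contradiction k<l k≮l
... | inj₂ l<k = l<k

record Ascent (w : Permutation′ n) (i j : Fin n) : Set where
  constructor ascent
  field
    i<j   : i < j
    wi<wj : val w i ℕ.< val w j

-- The local criterion for `w ⋖ swapAt w i j`. The equivalence is `cover⇒⋖` and `⋖⇒cover`, so the
-- combinatorics can avoid the Bruhat order.
record Cover (w : Permutation′ n) (i j : Fin n) : Set where
  constructor cover
  field
    isAscent   : Ascent w i j
    nonBetween : ∀ {k} → i < k → k < j → val w i ℕ.< val w k → ¬ (val w k ℕ.< val w j)
  open Ascent isAscent public

-- Dual inversion codes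

Coinversion : Permutation′ n → Fin n → Pred (Fin n) _
Coinversion w k l = k < l × val w k ℕ.< val w l

coinversion? : ∀ (w : Permutation′ n) k → Decidable (Coinversion w k)
coinversion? w k l = k <? l ×-dec val w k ℕₚ.<? val w l

coinvcode : Permutation′ n → Vector ℕ n
coinvcode w k = #[ coinversion? w k ]

coinv : Permutation′ n → ℕ
coinv w = sum (coinvcode w)

coinvcode+invcode : ∀ (w : Permutation′ n) k → coinvcode w k + invcode w k ≡ n ∸ suc (toℕ k)
coinvcode+invcode w k = trans (sym (#-⊎ (later? k) (coinversion? w k) _ total proj₁ proj₁ disjoint)) (#-later k)
  where
  total : ∀ {l} → k < l → Coinversion w k l ⊎ (k < l × val w l ℕ.< val w k)
  total k<l with val-<⊎> w (<⇒≢ k<l)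
  ... | inj₁ p = inj₁ (k<l , p)
  ... | inj₂ p = inj₂ (k<l , p)
  disjoint : ∀ {l} → Coinversion w k l → ¬ (k < l × val w l ℕ.< val w k)
  disjoint (_ , p) (_ , q) = ℕₚ.<-asym p q

coinvcode-zero : ∀ (w : Permutation′ n) {k} → coinvcode w k ≡ 0 → ∀ {l} → k < l → val w l ℕ.< val w k
coinvcode-zero w {k} c≡0 k<l = val-≮ w (<⇒≢ k<l) λ wk<wl →
  ℕₚ.<⇒≱ (#-positive (coinversion? w k) (k<l , wk<wl)) (ℕₚ.≤-reflexive c≡0)

coinvcode-zero⁻ : ∀ (w : Permutation′ n) {k} → (∀ {l} → k < l → val w l ℕ.< val w k) → coinvcode w k ≡ 0
coinvcode-zero⁻ w {k} descends = #-empty (coinversion? w k) λ (k<l , p) → ℕₚ.<-asym p (descends k<l)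

module _ {w : Permutation′ n} {i j : Fin n} (i↗j : Ascent w i j) where
  open Ascent i↗j

  private
    w′ = swapAt w i j

  Between : Pred (Fin n) _
  Between l = val w i ℕ.< val w l × val w l ℕ.< val w j

  between? : Decidable Between
  between? l = val w i ℕₚ.<? val w l ×-dec val w l ℕₚ.<? val w j

  private
    ¬between-j : ¬ Between j
    ¬between-j (_ , p) = ℕₚ.<-irrefl refl p

  laterBetween? : ∀ (k : Fin n) → Decidable (λ (l : Fin n) → k < l × Between l)
  laterBetween? k l = k <? l ×-dec between? l

  betweenCount : Fin n → ℕ
  betweenCount k = #[ laterBetween? k ]

  -- Raising the value at `i` to `w(j)` loses the coinversions `l` with `w(l) ≤ w(j)`: the position
  -- `j` itself and the positions after `i` with values strictly between.
  coinvcode-left : coinvcode w i ≡ coinvcode w′ i + suc (betweenCount i)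
  coinvcode-left = begin
    coinvcode w i
      ≡⟨ #-⊎ (coinversion? w i) (coinversion? w′ i) rest? split below rest⊆ disjoint ⟩
    coinvcode w′ i + #[ rest? ]
      ≡⟨ cong (coinvcode w′ i +_) (#-⊎ rest? (j ≟_) (laterBetween? i)
           splitRest (λ { refl → i<j , wi<wj , ℕₚ.≤-refl })
           (λ (p , q , r) → p , q , ℕₚ.<⇒≤ r) (λ { refl (_ , b) → ¬between-j b })) ⟩
    coinvcode w′ i + (#[ j ≟_ ] + betweenCount i)
      ≡⟨ cong (λ s → coinvcode w′ i + (s + betweenCount i)) (#-single j) ⟩
    coinvcode w′ i + suc (betweenCount i) ∎
    where
    open ≡-Reasoning
    rest? : Decidable (λ l → i < l × val w i ℕ.< val w l × val w l ≤ val w j)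
    rest? l = i <? l ×-dec val w i ℕₚ.<? val w l ×-dec val w l ℕₚ.≤? val w j
    split : ∀ {l} → Coinversion w i l →
            Coinversion w′ i l ⊎ (i < l × val w i ℕ.< val w l × val w l ≤ val w j)
    split {l} (i<l , wi<wl) with val w l ℕₚ.≤? val w j
    ... | yes p = inj₂ (i<l , wi<wl , p)
    ... | no ¬p = inj₁ (i<l , subst₂ ℕ._<_ (sym (val-left w i j))
      (sym (val-other w i j (>⇒≢ i<l) (λ { refl → ¬p ℕₚ.≤-refl }))) (ℕₚ.≰⇒> ¬p))
    below : ∀ {l} → Coinversion w′ i l → Coinversion w i l
    below {l} (i<l , p) with position i j l
    ... | left  = contradiction i<l (ℕₚ.<-irrefl refl)
    ... | right = i<l , wi<wj
    ... | other l≢i l≢j = i<l , ℕₚ.<-trans wi<wj (subst₂ ℕ._<_ (val-left w i j) (val-other w i j l≢i l≢j) p)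
    rest⊆ : ∀ {l} → i < l × val w i ℕ.< val w l × val w l ≤ val w j → Coinversion w i l
    rest⊆ (p , q , _) = p , q
    disjoint : ∀ {l} → Coinversion w′ i l → ¬ (i < l × val w i ℕ.< val w l × val w l ≤ val w j)
    disjoint {l} (i<l , p) (_ , q , r) with position i j l
    ... | left  = contradiction i<l (ℕₚ.<-irrefl refl)
    ... | right = ℕₚ.<-asym wi<wj (subst₂ ℕ._<_ (val-left w i j) (val-right w i j) p)
    ... | other l≢i l≢j = ℕₚ.<⇒≱ (subst₂ ℕ._<_ (val-left w i j) (val-other w i j l≢i l≢j) p) r
    splitRest : ∀ {l} → i < l × val w i ℕ.< val w l × val w l ≤ val w j → j ≡ l ⊎ (i < l × Between l)
    splitRest {l} (i<l , p , q) with j ≟ l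
    ... | yes j≡l = inj₁ j≡l
    ... | no  j≢l = inj₂ (i<l , p , ℕₚ.≤∧≢⇒< q (λ eq → j≢l (sym (val-injective w eq))))

  -- The value at `j` drops to `w(i)`, so the later positions with values strictly between become
  -- coinversions.
  coinvcode-right : coinvcode w′ j ≡ coinvcode w j + betweenCount j
  coinvcode-right = #-⊎ (coinversion? w′ j) (coinversion? w j) (laterBetween? j)
    split (λ { (j<l , p) → up j<l (ℕₚ.<-trans wi<wj p) }) (λ (j<l , p , _) → up j<l p)
    (λ (_ , p) (_ , _ , q) → ℕₚ.<-asym p q)
    where
    later : ∀ {l} → j < l → val w′ l ≡ val w l
    later j<l = val-other w i j (>⇒≢ (ℕₚ.<-trans i<j j<l)) (>⇒≢ j<l)
    up : ∀ {l} → j < l → val w i ℕ.< val w l → Coinversion w′ j l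
    up j<l p = j<l , subst₂ ℕ._<_ (sym (val-right w i j)) (sym (later j<l)) p
    split : ∀ {l} → Coinversion w′ j l → Coinversion w j l ⊎ (j < l × Between l)
    split {l} (j<l , p) with subst₂ ℕ._<_ (val-right w i j) (later j<l) p | val-<⊎> w (<⇒≢ j<l)
    ... | _ | inj₁ q = inj₁ (j<l , q)
    ... | p′ | inj₂ q = inj₂ (j<l , p′ , q)

  private
    before : ∀ {k l : Fin n} → k < i → k < l → k < PC.transpose i j l
    before {k} {l} k<i k<l with position i j l
    ... | left  = subst (k <_) (sym (transpose-left i j)) (ℕₚ.<-trans k<i i<j)
    ... | right = subst (k <_) (sym (transpose-right i j)) k<i
    ... | other l≢i l≢j = subst (k <_) (sym (transpose-other l≢i l≢j)) k<l

    before⁻ : ∀ {k l : Fin n} → k < i → k < PC.transpose i j l → k < l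
    before⁻ {k} {l} k<i k<l with position i j l
    ... | left  = k<i
    ... | right = ℕₚ.<-trans k<i i<j
    ... | other l≢i l≢j = subst (k <_) (transpose-other l≢i l≢j) k<l

  val-before : ∀ {k} → k < i → val w′ k ≡ val w k
  val-before k<i = val-other w i j (<⇒≢ k<i) (<⇒≢ (ℕₚ.<-trans k<i i<j))

  -- The transposition only permutes the positions after `k`, and the value at `k` stays.
  coinvcode-before : ∀ {k} → k < i → coinvcode w′ k ≡ coinvcode w k
  coinvcode-before {k} k<i = sym (trans
    (#-permute (coinversion? w k) (transpose i j))
    (#-cong (coinversion? w k ∘ PC.transpose i j) (coinversion? w′ k)
      (λ (p , q) → before⁻ k<i p , subst (ℕ._< _) (sym (val-before k<i)) q)
      (λ (p , q) → before k<i p , subst (ℕ._< _) (val-before k<i) q)))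

  descends-before⁻ : ∀ {k} → k < i → (∀ {l} → k < l → val w′ l ℕ.< val w′ k) →
                     ∀ {l} → k < l → val w l ℕ.< val w k
  descends-before⁻ k<i desc = coinvcode-zero w
    (trans (sym (coinvcode-before k<i)) (coinvcode-zero⁻ w′ desc))

  -- For `k` after `i`, only the value at `j` can change among the later positions, and it goes
  -- down.
  coinvcode-other-≤ : ∀ {k} → k ≢ i → k ≢ j → coinvcode w′ k ≤ coinvcode w k
  coinvcode-other-≤ {k} k≢i k≢j with ≢⇒<⊎> k≢i
  ... | inj₁ k<i = ℕₚ.≤-reflexive (coinvcode-before k<i)
  ... | inj₂ i<k = #-mono (coinversion? w′ k) (coinversion? w k) below
    where
    below : ∀ {l} → Coinversion w′ k l → Coinversion w k l
    below {l} (k<l , p) with position i j l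
    ... | left  = contradiction k<l (ℕₚ.<-asym i<k)
    ... | right = k<l , ℕₚ.<-trans (subst₂ ℕ._<_ (val-other w i j k≢i k≢j) (val-right w i j) p) wi<wj
    ... | other l≢i l≢j = k<l , subst₂ ℕ._<_ (val-other w i j k≢i k≢j) (val-other w i j l≢i l≢j) p

  betweenCount-≤ : betweenCount j ≤ betweenCount i
  betweenCount-≤ = #-mono (laterBetween? j) (laterBetween? i) λ (j<l , b) → ℕₚ.<-trans i<j j<l , b

  -- The loss at `i`, one more than `betweenCount i`, exceeds the gain `betweenCount j` at `j`. Loss
  -- and gain are added on opposite sides to avoid subtraction.
  coinv-< : coinv w′ ℕ.< coinv w
  coinv-< = ℕₚ.+-cancelʳ-≤ (betweenCount j) (suc (coinv w′)) (coinv w) (begin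
    suc (coinv w′) + betweenCount j      ≤⟨ ℕₚ.+-monoʳ-≤ (suc (coinv w′)) betweenCount-≤ ⟩
    suc (coinv w′) + betweenCount i      ≡⟨ ℕₚ.+-suc (coinv w′) _ ⟨
    coinv w′ + suc (betweenCount i)      ≡⟨ cong (coinv w′ +_) (sum-point i _) ⟨
    coinv w′ + sum (const (suc (betweenCount i)) ↾ (i ≟_))
      ≡⟨ ∑-distrib-+ (coinvcode w′) _ ⟨
    sum (coinvcode w′ ⊕ const (suc (betweenCount i)) ↾ (i ≟_))
      ≤⟨ sum-mono pointwise ⟩
    sum (coinvcode w ⊕ const (betweenCount j) ↾ (j ≟_))
      ≡⟨ ∑-distrib-+ (coinvcode w) _ ⟩
    coinv w + sum (const (betweenCount j) ↾ (j ≟_))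
      ≡⟨ cong (coinv w +_) (sum-point j _) ⟩
    coinv w + betweenCount j ∎)
    where
    open ℕₚ.≤-Reasoning
    pointwise : ∀ k → (coinvcode w′ ⊕ const (suc (betweenCount i)) ↾ (i ≟_)) k ≤
                      (coinvcode w ⊕ const (betweenCount j) ↾ (j ≟_)) k
    pointwise k with position i j k
    ... | left rewrite ↾-in (i ≟_) (const (suc (betweenCount i))) i refl =
      ℕₚ.≤-trans (ℕₚ.≤-reflexive (sym coinvcode-left)) (ℕₚ.m≤m+n _ _)
    ... | right rewrite ↾-out (i ≟_) (const (suc (betweenCount i))) j (<⇒≢ i<j)
                      | ↾-in (j ≟_) (const (betweenCount j)) j refl =
      ℕₚ.≤-reflexive (trans (ℕₚ.+-identityʳ _) coinvcode-right)
    ... | other k≢i k≢j rewrite ↾-out (i ≟_) (const (suc (betweenCount i))) k (≢-sym k≢i) =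
      ℕₚ.≤-trans (ℕₚ.≤-reflexive (ℕₚ.+-identityʳ _))
        (ℕₚ.≤-trans (coinvcode-other-≤ k≢i k≢j) (ℕₚ.m≤m+n _ _))

module _ {w : Permutation′ n} {i j : Fin n} (i⋖j : Cover w i j) where
  open Cover i⋖j

  private
    w′ = swapAt w i j

  betweenCount-cover : betweenCount isAscent i ≡ betweenCount isAscent j
  betweenCount-cover = #-cong (laterBetween? isAscent i) (laterBetween? isAscent j)
    (λ { (i<l , p , q) → after i<l p q , p , q })
    (λ (j<l , b) → ℕₚ.<-trans i<j j<l , b)
    where
    after : ∀ {l} → i < l → val w i ℕ.< val w l → val w l ℕ.< val w j → j < l
    after {l} i<l p q with Finₚ.<-cmp l j
    ... | tri< l<j _ _  = contradiction q (nonBetween i<l l<j p)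
    ... | tri≈ _ refl _ = contradiction q (ℕₚ.<-irrefl refl)
    ... | tri> _ _ j<l  = j<l

  -- If `k` lies between `i` and `j`, the cover condition keeps `w(k)` out of the interval from
  -- `w(i)` to `w(j)`, so the drop at `j` cannot destroy a coinversion of `k`.
  coinvcode-other : ∀ {k} → k ≢ i → k ≢ j → coinvcode w′ k ≡ coinvcode w k
  coinvcode-other {k} k≢i k≢j = ℕₚ.≤-antisym (coinvcode-other-≤ isAscent k≢i k≢j) (above (≢⇒<⊎> k≢i))
    where
    above : k < i ⊎ i < k → coinvcode w k ≤ coinvcode w′ k
    above (inj₁ k<i) = ℕₚ.≤-reflexive (sym (coinvcode-before isAscent k<i))
    above (inj₂ i<k) = #-mono (coinversion? w k) (coinversion? w′ k) keep
      where
      keep : ∀ {l} → Coinversion w k l → Coinversion w′ k l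
      keep {l} (k<l , p) with position i j l
      ... | left  = contradiction k<l (ℕₚ.<-asym i<k)
      ... | right = k<l , subst₂ ℕ._<_ (sym (val-other w i j k≢i k≢j)) (sym (val-right w i j))
        (val-≮ w (≢-sym k≢i) λ q → nonBetween i<k k<l q p)
      ... | other l≢i l≢j =
        k<l , subst₂ ℕ._<_ (sym (val-other w i j k≢i k≢j)) (sym (val-other w i j l≢i l≢j)) p

  -- A cover moves `betweenCount j` units of the code from `i` to `j` and removes one more at `i`.
  -- This form serves both the total (`coinv-cover`) and the initial sums (`coinv-head`).
  coinvcode-balance : coinvcode w′ ⊕ 𝐞 i ⊕ const (betweenCount isAscent j) ↾ (i ≟_) ≗
                      coinvcode w ⊕ const (betweenCount isAscent j) ↾ (j ≟_)
  coinvcode-balance k with position i j k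
  ... | left rewrite ↾-in (i ≟_) (const (betweenCount isAscent j)) i refl
                   | ↾-out (j ≟_) (const (betweenCount isAscent j)) i (>⇒≢ i<j)
                   | ↾-in (i ≟_) (const 1) i refl
                   | coinvcode-left isAscent | betweenCount-cover =
    trans (ℕₚ.+-assoc (coinvcode w′ i) 1 _) (sym (ℕₚ.+-identityʳ _))
  ... | right rewrite ↾-out (i ≟_) (const (betweenCount isAscent j)) j (<⇒≢ i<j)
                    | ↾-in (j ≟_) (const (betweenCount isAscent j)) j refl
                    | ↾-out (i ≟_) (const 1) j (<⇒≢ i<j) =
    trans (ℕₚ.+-identityʳ _) (trans (ℕₚ.+-identityʳ _) (coinvcode-right isAscent))
  ... | other k≢i k≢j rewrite ↾-out (i ≟_) (const (betweenCount isAscent j)) k (≢-sym k≢i)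
                            | ↾-out (j ≟_) (const (betweenCount isAscent j)) k (≢-sym k≢j)
                            | ↾-out (i ≟_) (const 1) k (≢-sym k≢i) =
    cong (_+ 0) (trans (ℕₚ.+-identityʳ _) (coinvcode-other k≢i k≢j))

  coinv-cover : suc (coinv w′) ≡ coinv w
  coinv-cover = ℕₚ.+-cancelʳ-≡ b (suc (coinv w′)) (coinv w) (begin
    suc (coinv w′) + b                 ≡⟨ cong (_+ b) (ℕₚ.+-comm 1 (coinv w′)) ⟩
    coinv w′ + 1 + b                   ≡⟨ cong₂ (λ x y → coinv w′ + x + y) (sum-point i 1) (sum-point i b) ⟨
    coinv w′ + sum (𝐞 i) + sum (const b ↾ (i ≟_))
      ≡⟨ cong (_+ sum (const b ↾ (i ≟_))) (∑-distrib-+ (coinvcode w′) (𝐞 i)) ⟨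
    sum (coinvcode w′ ⊕ 𝐞 i) + sum (const b ↾ (i ≟_))
      ≡⟨ ∑-distrib-+ (coinvcode w′ ⊕ 𝐞 i) _ ⟨
    sum (coinvcode w′ ⊕ 𝐞 i ⊕ const b ↾ (i ≟_))
      ≡⟨ sum-cong-≗ coinvcode-balance ⟩
    sum (coinvcode w ⊕ const b ↾ (j ≟_))
      ≡⟨ ∑-distrib-+ (coinvcode w) _ ⟩
    coinv w + sum (const b ↾ (j ≟_))
      ≡⟨ cong (coinv w +_) (sum-point j b) ⟩
    coinv w + b ∎)
    where
    open ≡-Reasoning
    b = betweenCount isAscent j

-- Increasing subsequences

-- Inc w p v m: there are m positions after p whose values increase from above v.

data Inc {n} (w : Permutation′ n) : Fin n → ℕ → ℕ → Set where
  []   : ∀ {p v} → Inc w p v 0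
  step : ∀ {p v m} q → p < q → v ℕ.< val w q → Inc w q (val w q) m → Inc w p v (suc m)

private
  Rises : Permutation′ n → Fin n → Fin n → Set
  Rises w p q = p < q × w ⟨$⟩ʳ p < w ⟨$⟩ʳ q

  Inc⇒Linked : ∀ {w : Permutation′ n} {p m} → Inc w p (val w p) m →
               ∃ λ qs → length qs ≡ m × Linked (Rises w) (p ∷ qs)
  Inc⇒Linked []                 = [] , refl , [-]
  Inc⇒Linked (step q p<q v<q s) =
    let qs , eq , l = Inc⇒Linked s in q ∷ qs , cong suc eq , (p<q , v<q) ∷ l

  Linked⇒Inc : ∀ {w : Permutation′ n} {p} qs → Linked (Rises w) (p ∷ qs) → Inc w p (val w p) (length qs)
  Linked⇒Inc []       _                   = []
  Linked⇒Inc (q ∷ qs) ((p<q , v<q) ∷ l) = step q p<q v<q (Linked⇒Inc qs l)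

[]∈subsequences : ∀ {a} {A : Set a} (xs : List A) → [] ∈ subsequences xs
[]∈subsequences []       = here refl
[]∈subsequences (x ∷ xs) = ∈-++⁺ʳ (map (x ∷_) (subsequences xs)) ([]∈subsequences xs)

-- Guarantees that the finite search in `rajcodeᵈ` meets every increasing sequence of positions.
sorted∈subsequences : ∀ {xs ys : List (Fin n)} → AllPairs _<_ xs → AllPairs _<_ ys →
                      All (_∈ ys) xs → xs ∈ subsequences ys
sorted∈subsequences {ys = ys} [] _ _ = []∈subsequences ys
sorted∈subsequences (x< ∷ xs<) (y< ∷ ys<) (here refl ∷ xs∈) =
  ∈-++⁺ˡ (∈-map⁺ _ (sorted∈subsequences xs< ys< (All.zipWith drop (x< , xs∈))))
  where
  drop : ∀ {y z ys} → y < z × z ∈ y ∷ ys → z ∈ ys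
  drop (y<y , here refl) = contradiction y<y (ℕₚ.<-irrefl refl)
  drop (_   , there z∈)  = z∈
sorted∈subsequences (x< ∷ xs<) (y< ∷ ys<) (there x∈ ∷ xs∈) =
  ∈-++⁺ʳ _ (sorted∈subsequences (x< ∷ xs<) ys< (x∈ ∷ All.zipWith drop (x< , xs∈)))
  where
  drop : ∀ {z} → _ < z × z ∈ _ ∷ _ → z ∈ _
  drop (x<y , here refl) = contradiction x<y (ℕₚ.<-asym (All.lookup y< x∈))
  drop (_   , there z∈)  = z∈

rajcodeᵈ-max : ∀ (w : Permutation′ n) {i m} → Inc w i (val w i) m → m ≤ rajcodeᵈ w i
rajcodeᵈ-max {n} w {i} s with Inc⇒Linked s
-- The `pred` in `rajcodeᵈ` removes the starting position `i`, which `Inc` does not count.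
... | qs , refl , l = ℕₚ.pred-mono-≤ (v≤max⁺ 0 _ (inj₂ (lose
        (∈-map⁺ length (∈-filter⁺ (increasingFrom? w i) member (refl , l))) ℕₚ.≤-refl)))
  where
  member : i ∷ qs ∈ subsequences (allFin n)
  member = sorted∈subsequences
    (Linkedₚ.Linked⇒AllPairs ℕₚ.<-trans (Linked.map proj₁ l))
    (AllPairsₚ.tabulate⁺-< id) (All.tabulate λ {q} _ → ∈-allFin q)

rajcodeᵈ-attained : ∀ (w : Permutation′ n) i → Inc w i (val w i) (rajcodeᵈ w i)
rajcodeᵈ-attained {n} w i
  with argmax-sel id 0 (map length (filter (increasingFrom? w i) (subsequences (allFin n))))
-- The base value `0` of the maximum has predecessor `0`, attained by the empty sequence.
... | inj₁ max≡0 rewrite max≡0 = []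
... | inj₂ max∈ with ∈-map⁻ length max∈
...   | α , α∈ , max≡ rewrite max≡ with α | proj₂ (∈-filter⁻ (increasingFrom? w i) {xs = subsequences (allFin n)} α∈)
...     | p ∷ qs | refl , l = Linked⇒Inc qs l

Inc-mono : ∀ {w : Permutation′ n} {p p′ v v′ m} → p′ Fin.≤ p → v′ ≤ v → Inc w p v m → Inc w p′ v′ m
Inc-mono p′≤p v′≤v []                 = []
Inc-mono p′≤p v′≤v (step q p<q v<q s) =
  step q (ℕₚ.≤-<-trans p′≤p p<q) (ℕₚ.≤-<-trans v′≤v v<q) s

Inc-pred : ∀ {w : Permutation′ n} {p v m} → Inc w p v (suc m) → Inc w p v m
Inc-pred {m = zero}  _                    = []
Inc-pred {m = suc m} (step q p<q v<q s) = step q p<q v<q (Inc-pred s)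

rajcodeᵈ-< : ∀ (w : Permutation′ n) {k l} → k < l → val w k ℕ.< val w l → rajcodeᵈ w l ℕ.< rajcodeᵈ w k
rajcodeᵈ-< w {l = l} k<l p = rajcodeᵈ-max w (step l k<l p (rajcodeᵈ-attained w l))

Inc-≤ : ∀ (w : Permutation′ n) {p v m} → Inc w p v m → m ≤ #[ (λ l → p <? l ×-dec v ℕₚ.<? val w l) ]
Inc-≤ w [] = z≤n
Inc-≤ {n} w {p} {v} {suc m} (step q p<q v<q s) = begin
  suc m                            ≡⟨ ℕₚ.+-comm 1 m ⟩
  m + 1                            ≤⟨ ℕₚ.+-mono-≤ (Inc-≤ w s) (ℕₚ.≤-reflexive (sym (#-single q))) ⟩
  #[ after? q (val w q) ] + #[ q ≟_ ]
    ≡⟨ #-⊎ either? (after? q (val w q)) (q ≟_) id inj₁ inj₂ (λ { (q<q , _) refl → ℕₚ.<-irrefl refl q<q }) ⟨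
  #[ either? ]                     ≤⟨ #-mono either? (after? p v) widen ⟩
  #[ after? p v ] ∎
  where
  open ℕₚ.≤-Reasoning
  after? : ∀ p v → Decidable (λ (l : Fin n) → p < l × v ℕ.< val w l)
  after? p v l = p <? l ×-dec v ℕₚ.<? val w l
  either? : Decidable (λ (l : Fin n) → (q < l × val w q ℕ.< val w l) ⊎ q ≡ l)
  either? l = after? q (val w q) l ⊎-dec (q ≟ l)
  widen : ∀ {l} → (q < l × val w q ℕ.< val w l) ⊎ q ≡ l → p < l × v ℕ.< val w l
  widen (inj₁ (q<l , r)) = ℕₚ.<-trans p<q q<l , ℕₚ.<-trans v<q r
  widen (inj₂ refl)      = p<q , v<q

rajcodeᵈ≤coinvcode : ∀ (w : Permutation′ n) k → rajcodeᵈ w k ≤ coinvcode w k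
rajcodeᵈ≤coinvcode w k = Inc-≤ w (rajcodeᵈ-attained w k)

coinvcode≤ : ∀ (w : Permutation′ n) k → coinvcode w k ≤ n ∸ suc (toℕ k)
coinvcode≤ w k = ℕₚ.≤-trans (ℕₚ.m≤m+n _ _) (ℕₚ.≤-reflexive (coinvcode+invcode w k))

rajcodeᵈ-zero : ∀ (w : Permutation′ n) {k} → coinvcode w k ≡ 0 → rajcodeᵈ w k ≡ 0
rajcodeᵈ-zero w {k} c≡0 = ℕₚ.n≤0⇒n≡0 (ℕₚ.≤-trans (rajcodeᵈ≤coinvcode w k) (ℕₚ.≤-reflexive c≡0))

-- Increasing subsequences under a cover

module _ {w : Permutation′ n} {i j : Fin n} (i⋖j : Cover w i j) where
  open Cover i⋖j

  private
    w′ = swapAt w i j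

  avoids : ∀ {k} → i < k → k < j → val w k ℕ.< val w i ⊎ val w j ≤ val w k
  avoids {k} i<k k<j with val w j ℕₚ.≤? val w k
  ... | yes wj≤wk = inj₂ wj≤wk
  ... | no  wj≰wk = inj₁ (val-≮ w (<⇒≢ i<k) λ wi<wk → nonBetween i<k k<j wi<wk (ℕₚ.≰⇒> wj≰wk))

  -- After `i` the link changes only the value at `j`, from `w(j)` to `w(i)`. A sequence through `j`
  -- survives if the value before it is below `w(i)`; `fits` excludes a preceding value from `w(i)`
  -- up to `w(j)`. At further terms this condition is `avoids`, and from `j` on it is vacuous.
  Inc-swap : ∀ {p v m} → i Fin.≤ p → (p < j → v ℕ.< val w i ⊎ val w j ≤ v) → Inc w p v m → Inc w′ p v m
  Inc-swap i≤p fits [] = []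
  Inc-swap {p} {v} i≤p fits (step q p<q v<q s) with position i j q
  ... | left  = contradiction p<q (ℕₚ.≤⇒≯ i≤p)
  ... | right = step j p<q (subst (v ℕ.<_) (sym (val-right w i j)) v<wi)
    (Inc-mono ℕₚ.≤-refl (ℕₚ.≤-trans (ℕₚ.≤-reflexive (val-right w i j)) (ℕₚ.<⇒≤ wi<wj))
      (Inc-swap (ℕₚ.<⇒≤ i<j) (λ j<j → contradiction j<j (ℕₚ.<-irrefl refl)) s))
    where
    v<wi : v ℕ.< val w i
    v<wi with fits p<q
    ... | inj₁ v<wi = v<wi
    ... | inj₂ wj≤v = contradiction v<q (ℕₚ.≤⇒≯ wj≤v)
  ... | other q≢i q≢j = step q p<q (subst (v ℕ.<_) (sym eq) v<q)
    (subst (λ x → Inc w′ q x _) (sym eq) (Inc-swap (ℕₚ.<⇒≤ i<q) (avoids i<q) s))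
    where
    eq = val-other w i j q≢i q≢j
    i<q = ℕₚ.≤-<-trans i≤p p<q

  Inc-swap-after : ∀ {v m} → Inc w j v m → Inc w′ j v m
  Inc-swap-after = Inc-swap (ℕₚ.<⇒≤ i<j) (λ j<j → contradiction j<j (ℕₚ.<-irrefl refl))

  rajcodeᵈ-mono : ∀ {k} → i < k → rajcodeᵈ w k ≤ rajcodeᵈ w′ k
  rajcodeᵈ-mono {k} i<k with position i j k
  ... | left  = contradiction i<k (ℕₚ.<-irrefl refl)
  ... | right = rajcodeᵈ-max w′ (Inc-mono ℕₚ.≤-refl
    (ℕₚ.≤-trans (ℕₚ.≤-reflexive (val-right w i j)) (ℕₚ.<⇒≤ wi<wj)) (Inc-swap-after (rajcodeᵈ-attained w j)))
  ... | other k≢i k≢j = rajcodeᵈ-max w′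
    (subst (λ x → Inc w′ k x _) (sym (val-other w i j k≢i k≢j))
      (Inc-swap (ℕₚ.<⇒≤ i<k) (avoids i<k) (rajcodeᵈ-attained w k)))

-- Marked climbing chains, inductively

_⊑_ : Maybe (Link n) → Fin n → Set
nothing       ⊑ i = ⊤
just (i′ , _) ⊑ i = i′ Fin.≤ i

-- MarkedChain w p t: a marked climbing chain of w with dual weight t that may
-- follow the link p, if any.

data MarkedChain {n} : Permutation′ n → Maybe (Link n) → Vector ℕ n → Set where
  top  : ∀ {w p t} → (∀ {k l} → k < l → val w l ℕ.< val w k) → t ≗ 𝟎 → MarkedChain w p t
  mark : ∀ {w p t t′ i j} → p ⊑ i → Cover w i j → MarkedChain (swapAt w i j) (just (i , j)) t′ →
         t ≗ t′ ⊕ 𝐞 i → MarkedChain w p t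
  skip : ∀ {w t i j j′} → j′ Fin.≤ j → Cover w i j′ → MarkedChain (swapAt w i j′) (just (i , j′)) t →
         MarkedChain w (just (i , j)) t

-- All later links lie in rows from `i` on and only permute positions after `k`. As the chain ends
-- at the longest permutation, row `k` must be finished already.
descends-before : ∀ {w : Permutation′ n} {i j t} → MarkedChain w (just (i , j)) t →
                  ∀ {k} → k < i → ∀ {l} → k < l → val w l ℕ.< val w k
descends-before (top desc _)      k<i = desc
descends-before (mark i≤i′ c K _) k<i = descends-before⁻ (Cover.isAscent c) k<i′ (descends-before K k<i′)
  where k<i′ = ℕₚ.<-≤-trans k<i i≤i′
descends-before (skip _ c K)      k<i = descends-before⁻ (Cover.isAscent c) k<i (descends-before K k<i)

rajcodeᵈ-descends : ∀ (w : Permutation′ n) {k} → (∀ {l} → k < l → val w l ℕ.< val w k) → rajcodeᵈ w k ≡ 0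
rajcodeᵈ-descends w desc = rajcodeᵈ-zero w (coinvcode-zero⁻ w desc)

dualWeight-before : ∀ {w : Permutation′ n} {i j t} → MarkedChain w (just (i , j)) t →
                    ∀ {k} → k < i → t k ≡ 0
dualWeight-before (top _ t≗0)        {k} k<i = t≗0 k
dualWeight-before (mark {i = i′} i≤i′ _ K t≗) {k} k<i = trans (t≗ k)
  (cong₂ _+_ (dualWeight-before K k<i′) (↾-out (i′ ≟_) (const 1) k (>⇒≢ k<i′)))
  where k<i′ = ℕₚ.<-≤-trans k<i i≤i′
dualWeight-before (skip _ _ K)       k<i = dualWeight-before K k<i

raj-descends : ∀ (w : Permutation′ n) → (∀ {k l} → k < l → val w l ℕ.< val w k) → sum (rajcodeᵈ w) ≡ 0
raj-descends {n} w desc = sum-zero {n} λ k → rajcodeᵈ-descends w {k} desc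

-- Lower bound for the final sums of a dual weight

off? : ∀ (i : Fin n) → Decidable (i ≢_)
off? i k = ¬? (i ≟ k)

rajOff : Permutation′ n → Fin n → ℕ
rajOff w i = sum (rajcodeᵈ w ↾ off? i)

module _ {w : Permutation′ n} {i j : Fin n} (i⋖j : Cover w i j)
         (descends : ∀ {k} → k < i → ∀ {l} → k < l → val w l ℕ.< val w k) where
  open Cover i⋖j

  private
    w′ = swapAt w i j

  rajcodeᵈ-off-mono : ∀ {k} → i ≢ k → rajcodeᵈ w k ≤ rajcodeᵈ w′ k
  rajcodeᵈ-off-mono {k} i≢k with ≢⇒<⊎> i≢k
  ... | inj₁ i<k = rajcodeᵈ-mono i⋖j i<k
  ... | inj₂ k<i = ℕₚ.≤-trans (ℕₚ.≤-reflexive (rajcodeᵈ-descends w (descends k<i))) z≤n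

  rajOff-mono : rajOff w i ≤ rajOff w′ i
  rajOff-mono = sum-mono (↾-mono (off? i) rajcodeᵈ-off-mono)

  -- The link puts `w(i)` at position `j`, where the entry changes from `rajcodeᵈ w j` to at least
  -- `m`; no other entry off `i` drops. The terms given up at `j` become available to the new value
  -- at `i` by `Inc-after`.
  rajOff-exchange : ∀ {m} → m ≤ rajcodeᵈ w′ j → rajOff w i + m ≤ rajOff w′ i + rajcodeᵈ w j
  rajOff-exchange {m} m≤ = begin
    rajOff w i + m
      ≡⟨ cong (rajOff w i +_) (sum-point j m) ⟨
    rajOff w i + sum (const m ↾ (j ≟_))
      ≡⟨ ∑-distrib-+ (rajcodeᵈ w ↾ off? i) _ ⟨
    sum (rajcodeᵈ w ↾ off? i ⊕ const m ↾ (j ≟_))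
      ≤⟨ sum-mono pointwise ⟩
    sum (rajcodeᵈ w′ ↾ off? i ⊕ const (rajcodeᵈ w j) ↾ (j ≟_))
      ≡⟨ ∑-distrib-+ (rajcodeᵈ w′ ↾ off? i) _ ⟩
    rajOff w′ i + sum (const (rajcodeᵈ w j) ↾ (j ≟_))
      ≡⟨ cong (rajOff w′ i +_) (sum-point j (rajcodeᵈ w j)) ⟩
    rajOff w′ i + rajcodeᵈ w j ∎
    where
    open ℕₚ.≤-Reasoning
    pointwise : ∀ k → (rajcodeᵈ w ↾ off? i ⊕ const m ↾ (j ≟_)) k ≤
                      (rajcodeᵈ w′ ↾ off? i ⊕ const (rajcodeᵈ w j) ↾ (j ≟_)) k
    pointwise k with position i j k
    ... | left rewrite ↾-out (off? i) (rajcodeᵈ w) i (λ i≢i → i≢i refl)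
                     | ↾-out (j ≟_) (const m) i (>⇒≢ i<j) = z≤n
    ... | right rewrite ↾-in (off? i) (rajcodeᵈ w) j (<⇒≢ i<j)
                      | ↾-in (off? i) (rajcodeᵈ w′) j (<⇒≢ i<j)
                      | ↾-in (j ≟_) (const m) j refl
                      | ↾-in (j ≟_) (const (rajcodeᵈ w j)) j refl =
      ℕₚ.≤-trans (ℕₚ.+-monoʳ-≤ (rajcodeᵈ w j) m≤) (ℕₚ.≤-reflexive (ℕₚ.+-comm (rajcodeᵈ w j) _))
    ... | other k≢i k≢j rewrite ↾-out (j ≟_) (const m) k (≢-sym k≢j) =
      ℕₚ.+-mono-≤ (↾-mono (off? i) rajcodeᵈ-off-mono k) z≤n

sum-⊕-𝐞 : ∀ {t t′ : Vector ℕ n} i → t ≗ t′ ⊕ 𝐞 i → sum t ≡ suc (sum t′)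
sum-⊕-𝐞 {t′ = t′} i t≗ = trans (sum-cong-≗ t≗) (trans (∑-distrib-+ t′ (𝐞 i))
  (trans (cong (sum t′ +_) (sum-point i 1)) (ℕₚ.+-comm (sum t′) 1)))

private
  descends-before⁻′ : ∀ {w : Permutation′ n} {i j t} → Cover w i j →
                      MarkedChain (swapAt w i j) (just (i , j)) t →
                      ∀ {k} → k < i → ∀ {l} → k < l → val w l ℕ.< val w k
  descends-before⁻′ c K k<i = descends-before⁻ (Cover.isAscent c) k<i (descends-before K k<i)

  Inc-after : ∀ {w : Permutation′ n} {i j} → Cover w i j →
              Inc (swapAt w i j) j (val (swapAt w i j) i) (rajcodeᵈ w j)
  Inc-after {w = w} {i} {j} c =
    subst (λ x → Inc (swapAt w i j) j x (rajcodeᵈ w j)) (sym (val-left w i j))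
    (Inc-swap-after c (rajcodeᵈ-attained w j))

  Inc⇒≤ : ∀ {w : Permutation′ n} {i j m} → i < j →
          Inc w j (val w i) m ⊎ Inc w i (val w i) (suc m) → m ≤ rajcodeᵈ w i
  Inc⇒≤ {w = w} i<j (inj₁ s) = rajcodeᵈ-max w (Inc-mono (ℕₚ.<⇒≤ i<j) ℕₚ.≤-refl s)
  Inc⇒≤ {w = w} i<j (inj₂ s) = rajcodeᵈ-max w (Inc-pred s)

-- In the chain of links (i, ∗), an unmarked link has j′ ≤ j, so what could follow
-- w(i) after position j can still follow it from its new position j′; this loses
-- nothing.  Only a marked link may cost one term of the longest sequence from i.

mutual
  -- Two states occur. In the first, `m` terms can follow `w(i)` beyond the position of the last
  -- link, which helps at an unmarked link because it does not move right. In the second, a sequence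
  -- from `i` has one term in reserve, to be lost at a later link.
  rajOff-chain : ∀ {w : Permutation′ n} {i j t m} → MarkedChain w (just (i , j)) t → i < j →
                 Inc w j (val w i) m ⊎ Inc w i (val w i) (suc m) → rajOff w i + m ≤ sum t
  rajOff-chain {w = w} {i} {j} {t} {m} (top desc t≗0) i<j s = begin
    rajOff w i + m               ≤⟨ ℕₚ.+-monoʳ-≤ (rajOff w i) (Inc⇒≤ i<j s) ⟩
    rajOff w i + rajcodeᵈ w i    ≡⟨ sum-off (rajcodeᵈ w) i ⟨
    sum (rajcodeᵈ w)             ≡⟨ raj-descends w desc ⟩
    0                            ≤⟨ z≤n ⟩
    sum t ∎
    where open ℕₚ.≤-Reasoning
  rajOff-chain {w = w} {i} {j} {t} {m} (mark _ c K t≗) i<j s = begin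
    rajOff w i + m               ≤⟨ ℕₚ.+-monoʳ-≤ (rajOff w i) (Inc⇒≤ i<j s) ⟩
    rajOff w i + rajcodeᵈ w i    ≡⟨ sum-off (rajcodeᵈ w) i ⟨
    sum (rajcodeᵈ w)             ≤⟨ raj-chain c K t≗ ⟩
    sum t ∎
    where open ℕₚ.≤-Reasoning
  rajOff-chain {w = w} {i} {j} {t} {m} (skip {j′ = j′} j′≤j c K) i<j (inj₁ s) = begin
    rajOff w i + m
      ≤⟨ rajOff-exchange c (descends-before⁻′ c K) (rajcodeᵈ-max w′ (Inc-mono ℕₚ.≤-refl
           (ℕₚ.≤-reflexive (val-right w i j′)) (Inc-swap-after c (Inc-mono j′≤j ℕₚ.≤-refl s)))) ⟩
    rajOff w′ i + rajcodeᵈ w j′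
      ≤⟨ rajOff-chain K (Cover.i<j c) (inj₁ (Inc-after c)) ⟩
    sum t ∎
    where
    open ℕₚ.≤-Reasoning
    w′ = swapAt w i j′
  rajOff-chain (skip _ c K) i<j (inj₂ s) = rajOff-link c K s

  -- A sequence starting above `w(j)` survives with its reserve. Otherwise the cover condition puts
  -- its first position `q` at or after `j`, so that `w(i)`, now at `j`, is followed by `m` terms,
  -- and `rajcodeᵈ w j` takes over in row `i`.
  rajOff-link : ∀ {w : Permutation′ n} {i j t m} → Cover w i j → MarkedChain (swapAt w i j) (just (i , j)) t →
                Inc w i (val w i) (suc m) → rajOff w i + m ≤ sum t
  rajOff-link {w = w} {i} {j} {t} {m} c K (step q i<q wi<wq s) with val w q ℕₚ.≤? val w j
  ... | no wq≰wj = begin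
    rajOff w i + m    ≤⟨ ℕₚ.+-monoˡ-≤ m (rajOff-mono c (descends-before⁻′ c K)) ⟩
    rajOff w′ i + m   ≤⟨ rajOff-chain K (Cover.i<j c) (inj₂ (step q i<q
      (subst₂ ℕ._<_ (sym (val-left w i j)) (sym eq) (ℕₚ.≰⇒> wq≰wj))
      (subst (λ x → Inc w′ q x m) (sym eq)
        (Inc-swap c (ℕₚ.<⇒≤ i<q) (λ _ → inj₂ (ℕₚ.<⇒≤ (ℕₚ.≰⇒> wq≰wj))) s)))) ⟩
    sum t ∎
    where
    open ℕₚ.≤-Reasoning
    w′ = swapAt w i j
    eq = val-other w i j (>⇒≢ i<q) λ { refl → wq≰wj ℕₚ.≤-refl }
  ... | yes wq≤wj = begin
    rajOff w i + m                ≤⟨ rajOff-exchange c (descends-before⁻′ c K) m≤ ⟩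
    rajOff w′ i + rajcodeᵈ w j    ≤⟨ rajOff-chain K i<j (inj₁ (Inc-after c)) ⟩
    sum t ∎
    where
    open ℕₚ.≤-Reasoning
    open Cover c
    w′ = swapAt w i j
    wi≤wj = ℕₚ.<⇒≤ wi<wj
    m≤ : m ≤ rajcodeᵈ w′ j
    m≤ with Finₚ.<-cmp q j
    ... | tri< q<j q≢j _ = contradiction (ℕₚ.≤∧≢⇒< wq≤wj (q≢j ∘ val-injective w)) (nonBetween i<q q<j wi<wq)
    ... | tri≈ _ refl _  = rajcodeᵈ-max w′ (Inc-mono ℕₚ.≤-refl
      (ℕₚ.≤-trans (ℕₚ.≤-reflexive (val-right w i j)) wi≤wj) (Inc-swap-after c s))
    -- All `m + 1` terms lie after `j` here, and one is given up.
    ... | tri> _ _ j<q   = rajcodeᵈ-max w′ (Inc-mono ℕₚ.≤-refl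
      (ℕₚ.≤-reflexive (val-right w i j)) (Inc-swap-after c (Inc-pred (step q j<q wi<wq s))))

  raj-chain : ∀ {w : Permutation′ n} {i j t t′} → Cover w i j → MarkedChain (swapAt w i j) (just (i , j)) t′ →
              t ≗ t′ ⊕ 𝐞 i → sum (rajcodeᵈ w) ≤ sum t
  raj-chain {w = w} {i} {j} {t} {t′} c K t≗ = begin
    sum (rajcodeᵈ w)            ≡⟨ sum-off (rajcodeᵈ w) i ⟩
    rajOff w i + rajcodeᵈ w i   ≤⟨ bound (rajcodeᵈ w i) (rajcodeᵈ-attained w i) ⟩
    suc (sum t′)                ≡⟨ sum-⊕-𝐞 i t≗ ⟨
    sum t ∎
    where
    open ℕₚ.≤-Reasoning
    bound : ∀ m → Inc w i (val w i) m → rajOff w i + m ≤ suc (sum t′)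
    bound zero    _ = ℕₚ.≤-trans (ℕₚ.≤-trans (ℕₚ.+-monoˡ-≤ 0 (rajOff-mono c (descends-before⁻′ c K)))
      (rajOff-chain K (Cover.i<j c) (inj₁ []))) (ℕₚ.n≤1+n _)
    bound (suc m) s = ℕₚ.≤-trans (ℕₚ.≤-reflexive (ℕₚ.+-suc (rajOff w i) m)) (s≤s (rajOff-link c K s))

from? : ∀ (i : Fin n) → Decidable {A = Fin n} (i Fin.≤_)
from? i k = i Finₚ.≤? k

-- Links in rows before `i` do not lower the entries of `rajcodeᵈ` from `i` on. The first link in a
-- row from `i` on opens that row and hence is marked. There `raj-chain` bounds the whole sum, and
-- the remaining dual weight vanishes before that row.
raj-tail : ∀ {w : Permutation′ n} {p t} → MarkedChain w p t → ∀ i → (∀ {i′ j} → p ≡ just (i′ , j) → i′ < i) →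
           sum (rajcodeᵈ w ↾ from? i) ≤ sum (t ↾ from? i)
raj-tail {w = w} {t = t} (top desc _) i _ = begin
  sum (rajcodeᵈ w ↾ from? i)  ≤⟨ sum-mono (↾-≤ (from? i) (rajcodeᵈ w)) ⟩
  sum (rajcodeᵈ w)            ≡⟨ raj-descends w desc ⟩
  0                           ≤⟨ z≤n ⟩
  sum (t ↾ from? i) ∎
  where open ℕₚ.≤-Reasoning
raj-tail {w = w} {t = t} (mark {t′ = t′} {i = i′} p⊑ c K t≗) i p<i with i′ <? i
... | yes i′<i = begin
  sum (rajcodeᵈ w ↾ from? i)
    ≤⟨ sum-mono (↾-mono (from? i) λ i≤k → rajcodeᵈ-mono c (ℕₚ.<-≤-trans i′<i i≤k)) ⟩
  sum (rajcodeᵈ (swapAt w i′ _) ↾ from? i)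
    ≤⟨ raj-tail K i (λ { refl → i′<i }) ⟩
  sum (t′ ↾ from? i)
    ≤⟨ sum-mono (↾-mono (from? i) λ {k} _ → ℕₚ.≤-trans (ℕₚ.m≤m+n _ _) (ℕₚ.≤-reflexive (sym (t≗ k)))) ⟩
  sum (t ↾ from? i) ∎
  where open ℕₚ.≤-Reasoning
... | no i′≮i = begin
  sum (rajcodeᵈ w ↾ from? i)
    ≤⟨ ℕₚ.m≤m+n _ _ ⟩
  sum (rajcodeᵈ w ↾ from? i) + sum (rajcodeᵈ w ↾ (¬? ∘ from? i))
    ≡⟨ sum-split (from? i) (rajcodeᵈ w) ⟨
  sum (rajcodeᵈ w)
    ≤⟨ raj-chain c K t≗ ⟩
  sum t
    ≤⟨ sum-mono supported ⟩
  sum (t ↾ from? i) ∎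
  where
  open ℕₚ.≤-Reasoning
  supported : ∀ k → t k ≤ (t ↾ from? i) k
  supported k with from? i k
  ... | yes i≤k = ℕₚ.≤-reflexive (sym (↾-in (from? i) t k i≤k))
  ... | no  i≰k = ℕₚ.≤-trans (ℕₚ.≤-reflexive (trans (t≗ k) (cong₂ _+_ (dualWeight-before K k<i′)
    (↾-out (i′ ≟_) (const 1) k (>⇒≢ k<i′))))) z≤n
    where k<i′ = ℕₚ.<-≤-trans (ℕₚ.≰⇒> i≰k) (ℕₚ.≮⇒≥ i′≮i)
raj-tail {w = w} {t = t} (skip {i = i′} {j′ = j′} _ c K) i p<i = begin
  sum (rajcodeᵈ w ↾ from? i)
    ≤⟨ sum-mono (↾-mono (from? i) λ i≤k → rajcodeᵈ-mono c (ℕₚ.<-≤-trans (p<i refl) i≤k)) ⟩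
  sum (rajcodeᵈ (swapAt w i′ j′) ↾ from? i)
    ≤⟨ raj-tail K i (λ { refl → p<i refl }) ⟩
  sum (t ↾ from? i) ∎
  where open ℕₚ.≤-Reasoning

-- Upper bounds for the initial sums and the entries of a dual weight

before? : ∀ (i : Fin n) → Decidable {A = Fin n} (_< i)
before? i k = k <? i

module _ {w : Permutation′ n} {i j : Fin n} (i⋖j : Cover w i j) where
  open Cover i⋖j

  private
    w′ = swapAt w i j

  coinvcode-upto : ∀ {k} → k Fin.≤ i → coinvcode w′ k + 𝐞 i k ≤ coinvcode w k
  coinvcode-upto {k} k≤i with i ≟ k
  ... | yes refl = ℕₚ.≤-trans (ℕₚ.+-monoʳ-≤ (coinvcode w′ i) (s≤s z≤n))
    (ℕₚ.≤-reflexive (sym (coinvcode-left isAscent)))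
  ... | no i≢k = ℕₚ.≤-reflexive (trans (ℕₚ.+-identityʳ _)
    (coinvcode-before isAscent (Finₚ.≤∧≢⇒< k≤i (≢-sym i≢k))))

  -- If `i < h`, the unit lost at `i` lies in the initial segment, and the units moved to `j` stay
  -- in it or leave it. Otherwise the entries before `h` do not change.
  coinv-head : ∀ h → sum ((coinvcode w′ ⊕ 𝐞 i) ↾ before? h) ≤ sum (coinvcode w ↾ before? h)
  coinv-head h with i <? h
  ... | no i≮h = sum-mono (↾-mono (before? h) λ k<h →
    coinvcode-upto (ℕₚ.<⇒≤ (ℕₚ.<-≤-trans k<h (ℕₚ.≮⇒≥ i≮h))))
  ... | yes i<h = ℕₚ.+-cancelʳ-≤ b _ _ (begin
    sum ((coinvcode w′ ⊕ 𝐞 i) ↾ before? h) + b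
      ≡⟨ cong (sum ((coinvcode w′ ⊕ 𝐞 i) ↾ before? h) +_) (sum-point i b) ⟨
    sum ((coinvcode w′ ⊕ 𝐞 i) ↾ before? h) + sum (const b ↾ (i ≟_))
      ≤⟨ ℕₚ.+-monoʳ-≤ _ (sum-mono inside-i) ⟩
    sum ((coinvcode w′ ⊕ 𝐞 i) ↾ before? h) + sum (const b ↾ (i ≟_) ↾ before? h)
      ≡⟨ ∑-distrib-+ ((coinvcode w′ ⊕ 𝐞 i) ↾ before? h) _ ⟨
    sum ((coinvcode w′ ⊕ 𝐞 i) ↾ before? h ⊕ const b ↾ (i ≟_) ↾ before? h)
      ≡⟨ sum-cong-≗ (↾-⊕ (before? h) (coinvcode w′ ⊕ 𝐞 i) (const b ↾ (i ≟_))) ⟨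
    sum ((coinvcode w′ ⊕ 𝐞 i ⊕ const b ↾ (i ≟_)) ↾ before? h)
      ≤⟨ sum-mono (↾-mono (before? h) λ {k} _ → ℕₚ.≤-reflexive (coinvcode-balance i⋖j k)) ⟩
    sum ((coinvcode w ⊕ const b ↾ (j ≟_)) ↾ before? h)
      ≡⟨ sum-cong-≗ (↾-⊕ (before? h) (coinvcode w) (const b ↾ (j ≟_))) ⟩
    sum (coinvcode w ↾ before? h ⊕ const b ↾ (j ≟_) ↾ before? h)
      ≡⟨ ∑-distrib-+ (coinvcode w ↾ before? h) _ ⟩
    sum (coinvcode w ↾ before? h) + sum (const b ↾ (j ≟_) ↾ before? h)
      ≤⟨ ℕₚ.+-monoʳ-≤ _ (sum-mono (↾-≤ (before? h) _)) ⟩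
    sum (coinvcode w ↾ before? h) + sum (const b ↾ (j ≟_))
      ≡⟨ cong (sum (coinvcode w ↾ before? h) +_) (sum-point j b) ⟩
    sum (coinvcode w ↾ before? h) + b ∎)
    where
    open ℕₚ.≤-Reasoning
    b = betweenCount isAscent j
    inside-i : ∀ k → (const b ↾ (i ≟_)) k ≤ (const b ↾ (i ≟_) ↾ before? h) k
    inside-i k with i ≟ k
    ... | no _     = z≤n
    ... | yes refl = ℕₚ.≤-reflexive (sym (↾-in (before? h) (const b) i i<h))

dualWeight-head : ∀ {w : Permutation′ n} {p t} → MarkedChain w p t → ∀ h →
                  sum (t ↾ before? h) ≤ sum (coinvcode w ↾ before? h)
dualWeight-head (top _ t≗0) h = sum-mono (↾-mono (before? h) λ {k} _ →
  ℕₚ.≤-trans (ℕₚ.≤-reflexive (t≗0 k)) z≤n)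
dualWeight-head {w = w} {t = t} (mark {t′ = t′} {i = i} {j} _ c K t≗) h = begin
  sum (t ↾ before? h)
    ≤⟨ sum-mono (↾-mono (before? h) λ {k} _ → ℕₚ.≤-reflexive (t≗ k)) ⟩
  sum ((t′ ⊕ 𝐞 i) ↾ before? h)
    ≡⟨ sum-⊕-↾ t′ ⟩
  sum (t′ ↾ before? h) + sum (𝐞 i ↾ before? h)
    ≤⟨ ℕₚ.+-monoˡ-≤ _ (dualWeight-head K h) ⟩
  sum (coinvcode (swapAt w i j) ↾ before? h) + sum (𝐞 i ↾ before? h)
    ≡⟨ sum-⊕-↾ (coinvcode (swapAt w i j)) ⟨
  sum ((coinvcode (swapAt w i j) ⊕ 𝐞 i) ↾ before? h)
    ≤⟨ coinv-head c h ⟩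
  sum (coinvcode w ↾ before? h) ∎
  where
  open ℕₚ.≤-Reasoning
  sum-⊕-↾ : ∀ v → sum ((v ⊕ 𝐞 i) ↾ before? h) ≡ sum (v ↾ before? h) + sum (𝐞 i ↾ before? h)
  sum-⊕-↾ v = trans (sum-cong-≗ (↾-⊕ (before? h) v (𝐞 i))) (∑-distrib-+ (v ↾ before? h) _)
dualWeight-head {w = w} {t = t} (skip {i = i} {j′ = j} _ c K) h = begin
  sum (t ↾ before? h)                                 ≤⟨ dualWeight-head K h ⟩
  sum (coinvcode (swapAt w i j) ↾ before? h)
    ≤⟨ sum-mono (↾-mono (before? h) λ _ → ℕₚ.m≤m+n _ _) ⟩
  sum ((coinvcode (swapAt w i j) ⊕ 𝐞 i) ↾ before? h)  ≤⟨ coinv-head c h ⟩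
  sum (coinvcode w ↾ before? h) ∎
  where open ℕₚ.≤-Reasoning

dualWeight-upto : ∀ {w : Permutation′ n} {i j t} → MarkedChain w (just (i , j)) t →
                  ∀ {k} → k Fin.≤ i → t k ≤ coinvcode w k
dualWeight-upto (top _ t≗0) {k} k≤i = ℕₚ.≤-trans (ℕₚ.≤-reflexive (t≗0 k)) z≤n
dualWeight-upto (mark i≤i′ c K t≗) {k} k≤i = ℕₚ.≤-trans (ℕₚ.≤-reflexive (t≗ k))
  (ℕₚ.≤-trans (ℕₚ.+-monoˡ-≤ _ (dualWeight-upto K k≤i′)) (coinvcode-upto c k≤i′))
  where k≤i′ = ℕₚ.≤-trans k≤i i≤i′
dualWeight-upto (skip _ c K) k≤i = ℕₚ.≤-trans (dualWeight-upto K k≤i)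
  (ℕₚ.≤-trans (ℕₚ.m≤m+n _ _) (coinvcode-upto c k≤i))

-- Makes `complement` exact on dual weights. Links in rows before `k` may raise `coinvcode` at `k`,
-- so the comparison with it starts only at the first link in a row from `k` on.
dualWeight-≤ : ∀ {w : Permutation′ n} {p t} → MarkedChain w p t → ∀ k → t k ≤ n ∸ suc (toℕ k)
dualWeight-≤ (top _ t≗0) k = ℕₚ.≤-trans (ℕₚ.≤-reflexive (t≗0 k)) z≤n
dualWeight-≤ {w = w} (mark {i = i} _ c K t≗) k with k Finₚ.≤? i
... | yes k≤i = ℕₚ.≤-trans (ℕₚ.≤-reflexive (t≗ k)) (ℕₚ.≤-trans (ℕₚ.+-monoˡ-≤ _ (dualWeight-upto K k≤i))
  (ℕₚ.≤-trans (coinvcode-upto c k≤i) (coinvcode≤ w k)))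
... | no k≰i = ℕₚ.≤-trans (ℕₚ.≤-reflexive (trans (t≗ k)
  (trans (cong (_ +_) (↾-out (i ≟_) (const 1) k (<⇒≢ (ℕₚ.≰⇒> k≰i)))) (ℕₚ.+-identityʳ _)))) (dualWeight-≤ K k)
dualWeight-≤ (skip _ c K) k = dualWeight-≤ K k

-- Attaining a dual weight

leastBy : ∀ (f : Fin n → ℕ) {P : Pred (Fin n) ℓ} → Decidable P → ∃ P →
          ∃ λ j → P j × (∀ {l} → P l → f j ≤ f l)
leastBy {n} f {P} P? (j , pj) = argmin f j (filter P? (allFin n)) ,
  argmin-all f {P = P} pj (all-filter P? (allFin n)) ,
  λ {l} pl → All.lookup (f[argmin]≤f[xs] j (filter P? (allFin n))) (∈-filter⁺ P? (∈-allFin l) pl)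

greatestBy : ∀ (f : Fin n → ℕ) {P : Pred (Fin n) ℓ} → Decidable P → ∃ P →
             ∃ λ j → P j × (∀ {l} → P l → f l ≤ f j)
greatestBy {n} f {P} P? (j , pj) = argmax f j (filter P? (allFin n)) ,
  argmax-all f {P = P} pj (all-filter P? (allFin n)) ,
  λ {l} pl → All.lookup (f[xs]≤f[argmax] j (filter P? (allFin n))) (∈-filter⁺ P? (∈-allFin l) pl)

Settled : Permutation′ n → Fin n → Set
Settled w i = ∀ {k} → k < i → coinvcode w k ≡ 0

data FirstUnsettled {n} (w : Permutation′ n) : Set where
  none : (∀ k → coinvcode w k ≡ 0) → FirstUnsettled w
  some : ∀ i → Settled w i → ∃ (Coinversion w i) → FirstUnsettled w

firstUnsettled : ∀ (w : Permutation′ n) → FirstUnsettled w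
firstUnsettled w with Finₚ.any? (λ k → Finₚ.any? (coinversion? w k))
... | no ¬∃  = none λ k → #-empty (coinversion? w k) λ {l} p → ¬∃ (k , l , p)
... | yes ∃k = let i , p , least = leastBy toℕ (λ k → Finₚ.any? (coinversion? w k)) ∃k in
  some i (λ {k} k<i → #-empty (coinversion? w k) λ {l} q → ℕₚ.<⇒≱ k<i (least (l , q))) p

-- A link (i, j) leaves all of the dual rajcode but its i-th entry alone when the
-- positions l after i with w(i) < w(l) < w(j) have smaller entries than j.

module _ {w : Permutation′ n} {i j : Fin n} (i↗j : Ascent w i j)
         (dominates : ∀ {l} → i < l → val w i ℕ.< val w l → val w l ℕ.< val w j →
                      rajcodeᵈ w l ℕ.< rajcodeᵈ w j) where
  open Ascent i↗j

  private
    w′ = swapAt w i j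

  -- A position `k` violating the cover condition would have a smaller entry than `j` by domination,
  -- and a larger one because it can precede `j` in an increasing sequence.
  dominating-cover : Cover w i j
  dominating-cover = cover i↗j λ i<k k<j p q →
    ℕₚ.<-asym (dominates i<k p q) (rajcodeᵈ-< w k<j q)

  private
    -- The old `rajcodeᵈ w` still decreases along increasing sequences of `w′` after `i`, and so
    -- bounds their lengths. The only new increasing pairs start at `j` and have `w(l)` between
    -- `w(i)` and `w(j)`, where domination applies.
    decreasing : ∀ {k l} → i < k → k < l → val w′ k ℕ.< val w′ l → rajcodeᵈ w l ℕ.< rajcodeᵈ w k
    decreasing {k} {l} i<k k<l p with position i j k | position i j l
    ... | left  | _     = contradiction i<k (ℕₚ.<-irrefl refl)
    ... | _     | left  = contradiction k<l (ℕₚ.<-asym i<k)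
    ... | right | right = contradiction k<l (ℕₚ.<-irrefl refl)
    ... | other k≢i k≢j | right = rajcodeᵈ-< w k<l
      (ℕₚ.<-trans (subst₂ ℕ._<_ (val-other w i j k≢i k≢j) (val-right w i j) p) wi<wj)
    ... | other k≢i k≢j | other l≢i l≢j = rajcodeᵈ-< w k<l
      (subst₂ ℕ._<_ (val-other w i j k≢i k≢j) (val-other w i j l≢i l≢j) p)
    ... | right | other l≢i l≢j with val-<⊎> w (≢-sym l≢j)
    ...   | inj₁ wj<wl = rajcodeᵈ-< w k<l wj<wl
    ...   | inj₂ wl<wj = dominates (ℕₚ.<-trans i<j k<l)
      (subst₂ ℕ._<_ (val-right w i j) (val-other w i j l≢i l≢j) p) wl<wj

    bounded : ∀ {k m} → i < k → Inc w′ k (val w′ k) m → m ≤ rajcodeᵈ w k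
    bounded i<k []                  = z≤n
    bounded i<k (step q k<q p s) = ℕₚ.≤-trans (s≤s (bounded (ℕₚ.<-trans i<k k<q) s)) (decreasing i<k k<q p)

  rajcodeᵈ-after : ∀ {k} → i < k → rajcodeᵈ w′ k ≡ rajcodeᵈ w k
  rajcodeᵈ-after {k} i<k =
    ℕₚ.≤-antisym (bounded i<k (rajcodeᵈ-attained w′ k)) (rajcodeᵈ-mono dominating-cover i<k)

  rajcodeᵈ-kept : Settled w i → ∀ {k} → i ≢ k → rajcodeᵈ w′ k ≡ rajcodeᵈ w k
  rajcodeᵈ-kept settled {k} i≢k with ≢⇒<⊎> i≢k
  ... | inj₁ i<k = rajcodeᵈ-after i<k
  ... | inj₂ k<i = trans (rajcodeᵈ-zero w′ (trans (coinvcode-before i↗j k<i) (settled k<i)))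
    (sym (rajcodeᵈ-zero w (settled k<i)))

  rajcodeᵈ-left-cases : rajcodeᵈ w′ i ≡ 0 ⊎
                        ∃ λ q → Coinversion w i q × val w j ℕ.< val w q × rajcodeᵈ w′ i ≤ suc (rajcodeᵈ w q)
  rajcodeᵈ-left-cases = cases (rajcodeᵈ-attained w′ i)
    where
    cases : ∀ {m} → Inc w′ i (val w′ i) m →
            m ≡ 0 ⊎ ∃ λ q → Coinversion w i q × val w j ℕ.< val w q × m ≤ suc (rajcodeᵈ w q)
    cases [] = inj₁ refl
    cases (step q i<q p s) = inj₂ (q , (i<q , ℕₚ.<-trans wi<wj wj<wq) , wj<wq , s≤s (bounded i<q s))
      where
      wj<wq : val w j ℕ.< val w q
      wj<wq with position i j q
      ... | left  = contradiction i<q (ℕₚ.<-irrefl refl)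
      ... | right = contradiction (subst₂ ℕ._<_ (val-left w i j) (val-right w i j) p) (ℕₚ.<-asym wi<wj)
      ... | other q≢i q≢j = subst₂ ℕ._<_ (val-left w i j) (val-other w i j q≢i q≢j) p

  rajcodeᵈ-left-≤ : rajcodeᵈ w′ i ≤ rajcodeᵈ w i
  rajcodeᵈ-left-≤ with rajcodeᵈ-left-cases
  ... | inj₁ r≡0                       = ℕₚ.≤-trans (ℕₚ.≤-reflexive r≡0) z≤n
  ... | inj₂ (q , (i<q , wi<wq) , _ , r≤) = ℕₚ.≤-trans r≤ (rajcodeᵈ-< w i<q wi<wq)

  rajcodeᵈ-left-≥ : rajcodeᵈ w j ≤ rajcodeᵈ w′ i
  rajcodeᵈ-left-≥ = rajcodeᵈ-max w′ (Inc-mono (ℕₚ.<⇒≤ i<j) (ℕₚ.≤-reflexive (val-left w i j))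
    (Inc-swap-after dominating-cover (rajcodeᵈ-attained w j)))

swap-settled : ∀ {w : Permutation′ n} {i j} → Ascent w i j → Settled w i → Settled (swapAt w i j) i
swap-settled {w = w} i↗j settled k<i = trans (coinvcode-before i↗j k<i) (settled k<i)

-- The positions l that could continue a longest increasing subsequence from i all
-- precede j, so that the next link of that kind need not be marked.

Runs : Permutation′ n → Fin n → Fin n → Set
Runs w i j = ∀ {l} → Coinversion w i l → rajcodeᵈ w i ≤ suc (rajcodeᵈ w l) → l < j

-- `raj-next` decides about the next link. If the entry of `i` has dropped, the last mark is used up
-- and the next link gets its own; if not, `Runs` allows the next link to stay unmarked.
record RajStep (w : Permutation′ n) (i : Fin n) : Set where
  field
    {j}       : Fin n
    i↗j       : Ascent w i j
    dominates : ∀ {l} → i < l → val w i ℕ.< val w l → val w l ℕ.< val w j → rajcodeᵈ w l ℕ.< rajcodeᵈ w j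
    raj-suc   : rajcodeᵈ w i ≡ suc (rajcodeᵈ w j)
    raj-next  : rajcodeᵈ (swapAt w i j) i ≡ rajcodeᵈ w j ⊎
                rajcodeᵈ (swapAt w i j) i ≡ rajcodeᵈ w i × Runs (swapAt w i j) i j

-- Among the values that can follow w(i) on a longest increasing subsequence, j is
-- the position of the least.

rajStepAt : ∀ {w : Permutation′ n} {i j} → Coinversion w i j →
            (∀ {l} → Coinversion w i l → rajcodeᵈ w l ≤ rajcodeᵈ w j) →
            (∀ {l} → Coinversion w i l → rajcodeᵈ w l ≡ rajcodeᵈ w j → val w j ≤ val w l) → RajStep w i
rajStepAt {n} {w} {i} {j} (i<j , wi<wj) maximal least = record
  { i↗j       = i↗j
  ; dominates = dominates
  ; raj-suc   = raj-suc
  ; raj-next  = next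
  }
  where
  w′ = swapAt w i j
  i↗j : Ascent w i j
  i↗j = ascent i<j wi<wj
  dominates : ∀ {l} → i < l → val w i ℕ.< val w l → val w l ℕ.< val w j → rajcodeᵈ w l ℕ.< rajcodeᵈ w j
  dominates i<l wi<wl wl<wj = ℕₚ.≤∧≢⇒< (maximal (i<l , wi<wl))
    λ rl≡rj → ℕₚ.<⇒≱ wl<wj (least (i<l , wi<wl) rl≡rj)
  raj-suc : rajcodeᵈ w i ≡ suc (rajcodeᵈ w j)
  raj-suc = ℕₚ.≤-antisym (upper (rajcodeᵈ-attained w i)) (rajcodeᵈ-< w i<j wi<wj)
    where
    upper : ∀ {m} → Inc w i (val w i) m → m ≤ suc (rajcodeᵈ w j)
    upper []                = z≤n
    upper (step q i<q p s) = s≤s (ℕₚ.≤-trans (rajcodeᵈ-max w s) (maximal (i<q , p)))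
  runs : rajcodeᵈ w′ i ≡ rajcodeᵈ w i → Runs w′ i j
  runs eq {l} (i<l , p) r≤ with position i j l
  ... | left  = contradiction i<l (ℕₚ.<-irrefl refl)
  ... | right = contradiction (subst₂ ℕ._<_ (val-left w i j) (val-right w i j) p) (ℕₚ.<-asym wi<wj)
  ... | other l≢i l≢j with ≢⇒<⊎> l≢j
  ...   | inj₁ l<j = l<j
  -- Such an `l` has `w(l) > w(j)`, so its entry is below that of `j`; continuing a sequence of
  -- undiminished length forces the opposite.
  ...   | inj₂ j<l = contradiction (ℕₚ.≤-trans rj≤rl
    (ℕₚ.≤-reflexive (rajcodeᵈ-after i↗j dominates i<l))) (ℕₚ.<⇒≱ (rajcodeᵈ-< w j<l wj<wl))
    where
    wj<wl = subst₂ ℕ._<_ (val-left w i j) (val-other w i j l≢i l≢j) p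
    rj≤rl : rajcodeᵈ w j ≤ rajcodeᵈ w′ l
    rj≤rl = ℕₚ.≤-pred (ℕₚ.≤-trans (ℕₚ.≤-reflexive (trans (sym raj-suc) (sym eq))) r≤)
  next : rajcodeᵈ w′ i ≡ rajcodeᵈ w j ⊎ rajcodeᵈ w′ i ≡ rajcodeᵈ w i × Runs w′ i j
  -- The new entry lies between `rajcodeᵈ w j` and `rajcodeᵈ w i`, which is one more, so only these
  -- two values are possible.
  next with ℕₚ.m≤n⇒m<n∨m≡n (rajcodeᵈ-left-≥ i↗j dominates)
  ... | inj₂ rj≡ = inj₁ (sym rj≡)
  ... | inj₁ rj< = inj₂ (eq , runs eq)
    where
    eq = ℕₚ.≤-antisym (rajcodeᵈ-left-≤ i↗j dominates) (ℕₚ.≤-trans (ℕₚ.≤-reflexive raj-suc) rj<)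

rajStep : ∀ (w : Permutation′ n) i → ∃ (Coinversion w i) → RajStep w i
rajStep w i ∃l =
  let g , ig , greatest = greatestBy (rajcodeᵈ w) (coinversion? w i) ∃l
      j , (ij , rj≡rg) , least = leastBy (val w)
        (λ l → coinversion? w i l ×-dec rajcodeᵈ w l ℕₚ.≟ rajcodeᵈ w g) (g , ig , refl)
  in rajStepAt ij (λ il → ℕₚ.≤-trans (greatest il) (ℕₚ.≤-reflexive (sym rj≡rg)))
       (λ il rl≡rj → least (il , trans rl≡rj rj≡rg))

⊕-𝐞-left : ∀ t (i : Fin n) → (t ⊕ 𝐞 i) i ≡ suc (t i)
⊕-𝐞-left t i = trans (cong (t i +_) (↾-in (i ≟_) (const 1) i refl)) (ℕₚ.+-comm (t i) 1)

⊕-𝐞-other : ∀ t {i k : Fin n} → i ≢ k → (t ⊕ 𝐞 i) k ≡ t k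
⊕-𝐞-other t {i} {k} i≢k = trans (cong (t k +_) (↾-out (i ≟_) (const 1) k i≢k)) (ℕₚ.+-identityʳ (t k))

∸-𝐞 : ∀ t (i : Fin n) → 1 ≤ t i → t ≗ (λ k → t k ∸ 𝐞 i k) ⊕ 𝐞 i
∸-𝐞 t i 1≤t k = sym (ℕₚ.m∸n+n≡m (below k))
  where
  below : ∀ k → 𝐞 i k ≤ t k
  below k with i ≟ k
  ... | yes refl = 1≤t
  ... | no _     = z≤n

-- The row condition for extending a chain: no unfinished row precedes that of the last link.
Follows : Maybe (Link n) → Permutation′ n → Set
Follows p w = ∀ {i} → ∃ (Coinversion w i) → p ⊑ i

settled⇒follows : ∀ {w : Permutation′ n} {i j} → Settled w i → Follows (just (i , j)) w
settled⇒follows {w = w} settled {k} (l , c) = ℕₚ.≮⇒≥ λ k<i →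
  ℕₚ.<⇒≱ (#-positive (coinversion? w k) c) (ℕₚ.≤-reflexive (settled k<i))

coinvcode-positive⁻ : ∀ (w : Permutation′ n) k → 1 ≤ coinvcode w k → ∃ (Coinversion w k)
coinvcode-positive⁻ w k 1≤c with Finₚ.any? (coinversion? w k)
... | yes ∃l = ∃l
... | no ¬∃l = contradiction 1≤c (ℕₚ.≤⇒≯ (ℕₚ.≤-reflexive (#-empty (coinversion? w k) λ {l} c → ¬∃l (l , c))))

-- The number f bounds the length of the chain.

mutual
  rajChain : ∀ f (w : Permutation′ n) → coinv w ℕ.< f → ∀ {p t} → Follows p w → t ≗ rajcodeᵈ w →
             MarkedChain w p t
  rajChain (suc f) w (s≤s T≤f) {p} {t} follows t≗ with firstUnsettled w
  ... | none c≗0 = top (λ {k} → coinvcode-zero w (c≗0 k)) λ k → trans (t≗ k) (rajcodeᵈ-zero w (c≗0 k))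
  ... | some i settled ∃l = mark (follows ∃l) (dominating-cover i↗j dominates)
    (rajContinue f w s (ℕₚ.<-≤-trans (coinv-< i↗j) T≤f) settled λ k → trans (sym (t≗t′ k)) (t≗ k)) t≗t′
    where
    s = rajStep w i ∃l
    open RajStep s
    t≗t′ = ∸-𝐞 t i (ℕₚ.≤-trans (s≤s z≤n) (ℕₚ.≤-reflexive (sym (trans (t≗ i) raj-suc))))

  -- Here a mark has been placed ahead of the drop it accounts for: `t ⊕ 𝐞 i` is still the dual
  -- rajcode, and links in row `i` stay unmarked until the entry of `i` goes down.
  rajRun : ∀ f (w : Permutation′ n) → coinv w ℕ.< f → ∀ {i j t} → Settled w i → ∃ (Coinversion w i) →
           Runs w i j → t ⊕ 𝐞 i ≗ rajcodeᵈ w → MarkedChain w (just (i , j)) t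
  rajRun (suc f) w (s≤s T≤f) {i} settled ∃l runs t≗ =
    skip (ℕₚ.<⇒≤ (runs (Ascent.i<j i↗j , Ascent.wi<wj i↗j) (ℕₚ.≤-reflexive raj-suc)))
      (dominating-cover i↗j dominates)
      (rajContinue f w s (ℕₚ.<-≤-trans (coinv-< i↗j) T≤f) settled t≗)
    where
    s = rajStep w i ∃l
    open RajStep s

  rajContinue : ∀ f (w : Permutation′ n) {i t} (s : RajStep w i) → let open RajStep s in
                coinv (swapAt w i j) ℕ.< f → Settled w i → t ⊕ 𝐞 i ≗ rajcodeᵈ w →
                MarkedChain (swapAt w i j) (just (i , j)) t
  rajContinue f w {i} {t} s T<f settled t≗ with RajStep.raj-next s
  ... | inj₁ r≡ = rajChain f w′ T<f (settled⇒follows {w = w′} {j = j} (swap-settled {w = w} i↗j settled)) t≗′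
    where
    open RajStep s
    w′ = swapAt w i j
    t≗′ : t ≗ rajcodeᵈ w′
    t≗′ k with i ≟ k
    ... | yes refl = trans (ℕₚ.suc-injective (trans (sym (⊕-𝐞-left t i)) (trans (t≗ i) raj-suc))) (sym r≡)
    ... | no i≢k   = trans (sym (⊕-𝐞-other t i≢k))
      (trans (t≗ k) (sym (rajcodeᵈ-kept i↗j dominates settled i≢k)))
  ... | inj₂ (r≡ , runs) = rajRun f w′ T<f (swap-settled {w = w} i↗j settled)
    (coinvcode-positive⁻ w′ i (ℕₚ.≤-trans 1≤r (rajcodeᵈ≤coinvcode w′ i))) runs t≗′
    where
    open RajStep s
    w′ = swapAt w i j
    1≤r : 1 ≤ rajcodeᵈ w′ i
    1≤r = ℕₚ.≤-trans (s≤s z≤n) (ℕₚ.≤-reflexive (sym (trans r≡ raj-suc)))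
    t≗′ : t ⊕ 𝐞 i ≗ rajcodeᵈ w′
    t≗′ k with i ≟ k
    ... | yes refl = trans (sym (cong (t i +_) (↾-in (i ≟_) (const 1) i refl))) (trans (t≗ i) (sym r≡))
    ... | no i≢k   = trans (sym (cong (t k +_) (↾-out (i ≟_) (const 1) k i≢k)))
      (trans (t≗ k) (sym (rajcodeᵈ-kept i↗j dominates settled i≢k)))

-- By `tight`, such a vector is `coinvcode` before some index and `rajcodeᵈ` after it. This is the
-- shape of `Lᵈ w d`, and the one that the induction in `attain` preserves.
record Attainable (w : Permutation′ n) (t : Vector ℕ n) : Set where
  field
    raj≤   : ∀ k → rajcodeᵈ w k ≤ t k
    ≤coinv : ∀ k → t k ≤ coinvcode w k
    tight  : ∀ {k l} → k < l → t k ℕ.< coinvcode w k → t l ≡ rajcodeᵈ w l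

module _ {w : Permutation′ n} {i j : Fin n} (ij : Coinversion w i j)
         (least : ∀ {l} → Coinversion w i l → val w j ≤ val w l) where

  private
    w′ = swapAt w i j
    i↗j : Ascent w i j
    i↗j = ascent (proj₁ ij) (proj₂ ij)

  least-dominates : ∀ {l} → i < l → val w i ℕ.< val w l → val w l ℕ.< val w j → rajcodeᵈ w l ℕ.< rajcodeᵈ w j
  least-dominates i<l p q = contradiction q (ℕₚ.≤⇒≯ (least (i<l , p)))

  private
    i⋖j = dominating-cover i↗j least-dominates
    betweenCount≡0 : betweenCount i↗j j ≡ 0
    betweenCount≡0 = #-empty (laterBetween? i↗j j)
      λ (j<l , p , q) → ℕₚ.<⇒≱ q (least (ℕₚ.<-trans (proj₁ ij) j<l , p))

  -- No position after `i` has a value strictly between `w(i)` and `w(j)`, so no units move from `i`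
  -- to `j`.
  least-coinvcode : coinvcode w ≗ coinvcode w′ ⊕ 𝐞 i
  least-coinvcode k with position i j k
  ... | left = trans (coinvcode-left i↗j) (trans
    (cong (λ b → coinvcode w′ i + suc b) (trans (betweenCount-cover i⋖j) betweenCount≡0))
    (cong (coinvcode w′ i +_) (sym (↾-in (i ≟_) (const 1) i refl))))
  ... | right = trans (sym (trans (coinvcode-right i↗j)
    (trans (cong (coinvcode w j +_) betweenCount≡0) (ℕₚ.+-identityʳ _))))
    (sym (⊕-𝐞-other (coinvcode w′) (<⇒≢ (proj₁ ij))))
  ... | other k≢i k≢j = trans (sym (coinvcode-other i⋖j k≢i k≢j)) (sym (⊕-𝐞-other (coinvcode w′) (≢-sym k≢i)))

  -- The link lowers `t` and `coinvcode` by the same `𝐞 i` and keeps `rajcodeᵈ` outside row `i`.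
  -- Only the lower bound in row `i` is at risk: either `t` has a unit to spare above `rajcodeᵈ`, or
  -- it equals `coinvcode` and keeps doing so.
  least-attainable : ∀ {t t′} → Settled w i → Attainable w t → rajcodeᵈ w i ℕ.< t i ⊎ t i ≡ coinvcode w i →
                     t ≗ t′ ⊕ 𝐞 i → Attainable w′ t′
  least-attainable {t} {t′} settled attainable room t≗ = record
    { raj≤   = lower
    ; ≤coinv = λ k → ℕₚ.+-cancelʳ-≤ (𝐞 i k) _ _
        (subst₂ _≤_ (t≗ k) (least-coinvcode k) (≤coinv k))
    ; tight  = tight′
    }
    where
    open Attainable attainable
    kept : ∀ {k} → i ≢ k → rajcodeᵈ w′ k ≡ rajcodeᵈ w k
    kept = rajcodeᵈ-kept i↗j least-dominates settled
    t-other : ∀ {k} → i ≢ k → t k ≡ t′ k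
    t-other {k} i≢k = trans (t≗ k) (⊕-𝐞-other t′ i≢k)
    t-left : t i ≡ suc (t′ i)
    t-left = trans (t≗ i) (⊕-𝐞-left t′ i)
    left-lower : rajcodeᵈ w i ℕ.< t i ⊎ t i ≡ coinvcode w i → rajcodeᵈ w′ i ≤ t′ i
    left-lower (inj₁ r<t) = ℕₚ.≤-trans (rajcodeᵈ-left-≤ i↗j least-dominates)
      (ℕₚ.≤-pred (ℕₚ.≤-trans r<t (ℕₚ.≤-reflexive t-left)))
    left-lower (inj₂ t≡c) = ℕₚ.≤-trans (rajcodeᵈ≤coinvcode w′ i) (ℕₚ.≤-reflexive (ℕₚ.suc-injective
      (trans (sym (trans (least-coinvcode i) (⊕-𝐞-left (coinvcode w′) i))) (trans (sym t≡c) t-left))))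
    lower : ∀ k → rajcodeᵈ w′ k ≤ t′ k
    lower k with i ≟ k
    ... | yes refl = left-lower room
    ... | no i≢k   = subst₂ _≤_ (sym (kept i≢k)) (t-other i≢k) (raj≤ k)
    tight′ : ∀ {k l} → k < l → t′ k ℕ.< coinvcode w′ k → t′ l ≡ rajcodeᵈ w′ l
    tight′ {k} {l} k<l t′<c = go (i ≟ l)
      where
      t<c : t k ℕ.< coinvcode w k
      t<c = subst₂ ℕ._<_ (sym (t≗ k)) (sym (least-coinvcode k)) (ℕₚ.+-monoˡ-< (𝐞 i k) t′<c)
      go : Dec (i ≡ l) → t′ l ≡ rajcodeᵈ w′ l
      -- Row `k` comes before `i`, so its `coinvcode` is zero and `t` cannot be below it.
      go (yes refl) = contradiction (ℕₚ.≤-trans t<c (ℕₚ.≤-reflexive (settled k<l))) λ ()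
      go (no i≢l)   = trans (sym (t-other i≢l)) (trans (tight k<l t<c) (sym (kept i≢l)))

attain : ∀ f (w : Permutation′ n) → coinv w ℕ.< f → ∀ {p t} → Follows p w → Attainable w t → MarkedChain w p t
attain (suc f) w T<f@(s≤s T≤f) {p} {t} follows attainable with firstUnsettled w
... | none c≗0 = top (λ {k} → coinvcode-zero w (c≗0 k))
  λ k → ℕₚ.n≤0⇒n≡0 (ℕₚ.≤-trans (Attainable.≤coinv attainable k) (ℕₚ.≤-reflexive (c≗0 k)))
... | some i settled ∃l = decide (rajcodeᵈ w i ℕₚ.<? t i) (t i ℕₚ.≟ coinvcode w i)
  where
  open Attainable attainable
  ℓ∃ = leastBy (val w) (coinversion? w i) ∃l
  j = proj₁ ℓ∃
  ij : Coinversion w i j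
  ij = proj₁ (proj₂ ℓ∃)
  least : ∀ {l} → Coinversion w i l → val w j ≤ val w l
  least = proj₂ (proj₂ ℓ∃)
  i↗j : Ascent w i j
  i↗j = ascent (proj₁ ij) (proj₂ ij)
  1≤c : 1 ≤ coinvcode w i
  1≤c = #-positive (coinversion? w i) ij
  next : 1 ≤ t i → rajcodeᵈ w i ℕ.< t i ⊎ t i ≡ coinvcode w i → MarkedChain w p t
  next 1≤t room = mark (follows ∃l) (dominating-cover i↗j (least-dominates {w = w} ij least))
    (attain f (swapAt w i j) (ℕₚ.<-≤-trans (coinv-< i↗j) T≤f)
      (settled⇒follows {w = swapAt w i j} {j = j} (swap-settled {w = w} i↗j settled))
      (least-attainable {w = w} ij least settled attainable room t≗))
    t≗
    where t≗ = ∸-𝐞 t i 1≤t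
  decide : Dec (rajcodeᵈ w i ℕ.< t i) → Dec (t i ≡ coinvcode w i) → MarkedChain w p t
  decide (yes r<t) _         = next (ℕₚ.≤-trans (s≤s z≤n) r<t) (inj₁ r<t)
  decide (no _)    (yes t≡c) = next (ℕₚ.≤-trans 1≤c (ℕₚ.≤-reflexive (sym t≡c))) (inj₂ t≡c)
  -- The entry of `t` at `i` is down to `rajcodeᵈ` and below `coinvcode`, so `tight` gives
  -- `rajcodeᵈ` in all later rows. The second rule takes over, possibly in the middle of a row.
  decide (no r≮t)  (no t≢c)  = rajChain (suc f) w T<f follows t≗r
    where
    t≗r : t ≗ rajcodeᵈ w
    t≗r k with Finₚ.<-cmp k i
    ... | tri< k<i _ _  = trans (ℕₚ.n≤0⇒n≡0 (ℕₚ.≤-trans (≤coinv k) (ℕₚ.≤-reflexive (settled k<i))))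
      (sym (rajcodeᵈ-zero w (settled k<i)))
    ... | tri≈ _ refl _ = ℕₚ.≤-antisym (ℕₚ.≮⇒≥ r≮t) (raj≤ k)
    ... | tri> _ _ i<k  = tight i<k (ℕₚ.≤∧≢⇒< (≤coinv i) t≢c)

-- The vectors L_w

last-nothing : ∀ {a} {A : Set a} (xs : List A) → last xs ≡ nothing → xs ≡ []
last-nothing []           _  = refl
last-nothing (x ∷ y ∷ xs) eq = contradiction (last-nothing (y ∷ xs) eq) λ ()

last-just : ∀ {xs : List (Fin n)} {j} → AllPairs _<_ xs → last xs ≡ just j → j ∈ xs × All (Fin._≤ j) xs
last-just {xs = x ∷ []}     _          refl = here refl , ℕₚ.≤-refl ∷ []
last-just {xs = x ∷ y ∷ xs} (x< ∷ xs<) eq   =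
  let j∈ , ≤j = last-just xs< eq in there j∈ , ℕₚ.<⇒≤ (All.lookup x< j∈) ∷ ≤j

module _ {P : Pred (Fin n) ℓ} (P? : Decidable P) where

  last-filter-nothing : last (filter P? (allFin n)) ≡ nothing → ∀ {k} → ¬ P k
  last-filter-nothing eq {k} pk = contradiction
    (subst (k ∈_) (last-nothing (filter P? (allFin n)) eq) (∈-filter⁺ P? (∈-allFin k) pk)) λ ()

  last-filter-just : ∀ {j} → last (filter P? (allFin n)) ≡ just j → P j × (∀ {k} → j < k → ¬ P k)
  last-filter-just {j} eq =
    let j∈ , ≤j = last-just (AllPairsₚ.filter⁺ P? (AllPairsₚ.tabulate⁺-< id)) eq in
    proj₂ (∈-filter⁻ P? {xs = allFin n} j∈) ,
    λ {k} j<k pk → ℕₚ.<⇒≱ j<k (All.lookup ≤j (∈-filter⁺ P? (∈-allFin k) pk))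

invcode-complement : ∀ (w : Permutation′ n) → complement (invcode w) ≗ coinvcode w
invcode-complement w k = trans (cong (_∸ invcode w k) (sym (coinvcode+invcode w k)))
  (ℕₚ.m+n∸n≡m (coinvcode w k) (invcode w k))

coinvcode-complement : ∀ (w : Permutation′ n) → complement (coinvcode w) ≗ invcode w
coinvcode-complement w k = trans (cong (_∸ coinvcode w k) (sym (coinvcode+invcode w k)))
  (ℕₚ.m+n∸m≡n (coinvcode w k) _)

rajcodeᵈ≤ : ∀ (w : Permutation′ n) k → rajcodeᵈ w k ≤ n ∸ suc (toℕ k)
rajcodeᵈ≤ w k = ℕₚ.≤-trans (rajcodeᵈ≤coinvcode w k) (coinvcode≤ w k)

invcode≤rajcode : ∀ (w : Permutation′ n) k → invcode w k ≤ rajcode w k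
invcode≤rajcode {n} w k = ℕₚ.≤-trans (ℕₚ.≤-reflexive (sym (coinvcode-complement w k)))
  (ℕₚ.∸-monoʳ-≤ (n ∸ suc (toℕ k)) (rajcodeᵈ≤coinvcode w k))

-- `Attainable` seen through `complement`, together with the total that will fix the number of
-- marks.
record Filling (w : Permutation′ n) (d : ℕ) (v : Vector ℕ n) : Set where
  field
    inv≤  : ∀ k → invcode w k ≤ v k
    ≤raj  : ∀ k → v k ≤ rajcode w k
    total : sum v ≡ inv w + d
    tight : ∀ {k l} → k < l → invcode w k ℕ.< v k → v l ≡ rajcode w l

-- The incremented index is the largest one not yet full, so all later entries are full; this gives
-- `tight` for the new vector.
L-filling : ∀ (w : Permutation′ n) d → d ≤ raj w ∸ inv w → Filling w d (L w d)
L-filling w zero _ = record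
  { inv≤  = λ _ → ℕₚ.≤-refl
  ; ≤raj  = invcode≤rajcode w
  ; total = sym (ℕₚ.+-identityʳ (inv w))
  ; tight = λ _ p → contradiction p (ℕₚ.<-irrefl refl)
  }
L-filling {n} w (suc d) d<D = next (last (filter unfilled? (allFin n))) refl
  where
  open Filling (L-filling w d (ℕₚ.<⇒≤ d<D))
  unfilled? : Decidable (λ (j : Fin n) → L w d j ℕ.< rajcode w j)
  unfilled? j = L w d j ℕₚ.<? rajcode w j
  next : ∀ mj → last (filter unfilled? (allFin n)) ≡ mj →
         Filling w (suc d) (maybe (λ j → L w d ⊕ 𝐞 j) (L w d) mj)
  -- If every entry were full, the total `inv w + d` would be `raj w`, against `d < raj w ∸ inv w`.
  next nothing eq = contradiction d<D (ℕₚ.≤⇒≯ (ℕₚ.≤-reflexive (begin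
    raj w ∸ inv w          ≡⟨ cong (_∸ inv w) (sum-cong-≗ full) ⟨
    sum (L w d) ∸ inv w    ≡⟨ cong (_∸ inv w) total ⟩
    inv w + d ∸ inv w      ≡⟨ ℕₚ.m+n∸m≡n (inv w) d ⟩
    d ∎)))
    where
    open ≡-Reasoning
    full : L w d ≗ rajcode w
    full k = ℕₚ.≤-antisym (≤raj k) (ℕₚ.≮⇒≥ (last-filter-nothing unfilled? eq))
  next (just j) eq = record
    { inv≤  = λ k → ℕₚ.≤-trans (inv≤ k) (ℕₚ.m≤m+n _ _)
    ; ≤raj  = upper
    ; total = trans (sum-⊕-𝐞 j (λ _ → refl)) (trans (cong suc total) (sym (ℕₚ.+-suc (inv w) d)))
    ; tight = tight′
    }
    where
    v = L w d
    unfilled-j = proj₁ (last-filter-just unfilled? eq)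
    filled-after : ∀ {k} → j < k → v k ≡ rajcode w k
    filled-after {k} j<k = ℕₚ.≤-antisym (≤raj k) (ℕₚ.≮⇒≥ (proj₂ (last-filter-just unfilled? eq) j<k))
    upper : ∀ k → (v ⊕ 𝐞 j) k ≤ rajcode w k
    upper k with j ≟ k
    ... | yes refl = ℕₚ.≤-trans (ℕₚ.≤-reflexive (ℕₚ.+-comm (v j) 1)) unfilled-j
    ... | no _     = ℕₚ.≤-trans (ℕₚ.≤-reflexive (ℕₚ.+-identityʳ (v k))) (≤raj k)
    tight′ : ∀ {k l} → k < l → invcode w k ℕ.< (v ⊕ 𝐞 j) k → (v ⊕ 𝐞 j) l ≡ rajcode w l
    tight′ {k} {l} k<l inv< = trans (⊕-𝐞-other v j≢l) vl≡
      where
      cases : Dec (j ≡ k) → v l ≡ rajcode w l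
      cases (yes refl) = filled-after k<l
      cases (no j≢k)   = tight k<l (ℕₚ.<-≤-trans inv< (ℕₚ.≤-reflexive (⊕-𝐞-other v j≢k)))
      vl≡ = cases (j ≟ k)
      j≢l : j ≢ l
      j≢l refl = ℕₚ.<-irrefl vl≡ unfilled-j

module _ {w : Permutation′ n} {d v} (filling : Filling w d v) where
  open Filling filling

  filling-≤ : ∀ k → v k ≤ n ∸ suc (toℕ k)
  filling-≤ k = ℕₚ.≤-trans (≤raj k) (ℕₚ.m∸n≤m _ (rajcodeᵈ w k))

  filling-attainable : Attainable w (complement v)
  filling-attainable = record
    { raj≤   = λ k → ℕₚ.≤-trans (ℕₚ.≤-reflexive (sym (rajcode-complement k)))
        (ℕₚ.∸-monoʳ-≤ (n ∸ suc (toℕ k)) (≤raj k))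
    ; ≤coinv = λ k → ℕₚ.≤-trans (ℕₚ.∸-monoʳ-≤ (n ∸ suc (toℕ k)) (inv≤ k)) (ℕₚ.≤-reflexive (invcode-complement w k))
    ; tight  = λ {k} {l} k<l t<c → trans
        (cong (n ∸ suc (toℕ l) ∸_) (tight k<l (ℕₚ.≰⇒> λ v≤inv → ℕₚ.<⇒≱ t<c
          (ℕₚ.≤-trans (ℕₚ.≤-reflexive (sym (invcode-complement w k))) (ℕₚ.∸-monoʳ-≤ (n ∸ suc (toℕ k)) v≤inv)))))
        (rajcode-complement l)
    }
    where
    rajcode-complement : complement (rajcode w) ≗ rajcodeᵈ w
    rajcode-complement k = ℕₚ.m∸[m∸n]≡n (rajcodeᵈ≤ w k)

  filling-total : sum (complement v) + d ≡ coinv w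
  filling-total = ℕₚ.+-cancelˡ-≡ (inv w) _ _ (begin
    inv w + (sum (complement v) + d)   ≡⟨ cong (inv w +_) (ℕₚ.+-comm _ d) ⟩
    inv w + (d + sum (complement v))   ≡⟨ ℕₚ.+-assoc (inv w) d _ ⟨
    inv w + d + sum (complement v)     ≡⟨ cong (_+ sum (complement v)) total ⟨
    sum v + sum (complement v)         ≡⟨ ∑-distrib-+ v (complement v) ⟨
    sum (v ⊕ complement v)             ≡⟨ sum-cong-≗ (λ k → trans (ℕₚ.m+[n∸m]≡n (filling-≤ k))
      (trans (sym (coinvcode+invcode w k)) (ℕₚ.+-comm (coinvcode w k) _))) ⟩
    sum (invcode w ⊕ coinvcode w)      ≡⟨ ∑-distrib-+ (invcode w) (coinvcode w) ⟩
    inv w + coinv w ∎)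
    where open ≡-Reasoning

-- Dominance and term orders

-- The dominance order read from the last index, for vectors that need not be sorted.
record Dominated (u v : Vector ℕ n) : Set where
  field
    total : sum u ≡ sum v
    tails : ∀ i → sum (u ↾ from? i) ≤ sum (v ↾ from? i)

sum-before-from : ∀ (v : Vector ℕ n) i → sum v ≡ sum (v ↾ before? i) + sum (v ↾ from? i)
sum-before-from v i = trans (sum-split (before? i) v) (cong (sum (v ↾ before? i) +_) (sum-cong-≗ same))
  where
  same : v ↾ (¬? ∘ before? i) ≗ v ↾ from? i
  same k = cases (before? i k)
    where
    cases : Dec (k < i) → (v ↾ (¬? ∘ before? i)) k ≡ (v ↾ from? i) k
    cases (yes k<i) = trans (↾-out (¬? ∘ before? i) v k (λ k≮i → k≮i k<i))
      (sym (↾-out (from? i) v k (ℕₚ.<⇒≱ k<i)))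
    cases (no k≮i)  = trans (↾-in (¬? ∘ before? i) v k k≮i) (sym (↾-in (from? i) v k (ℕₚ.≮⇒≥ k≮i)))

-- If `t` agrees with `rajcodeᵈ` from `i` on, `raj-tail` applies. Otherwise `tight` makes `t` equal
-- to `coinvcode` before `i`, so its initial sum is at least that of `v`, and equal totals turn this
-- into the bound on final sums.
attainable-dominated : ∀ {w : Permutation′ n} {t v} → Attainable w t → MarkedChain w nothing v →
                       sum t ≡ sum v → Dominated t v
attainable-dominated {n} {w} {t} {v} attainable K total = record
  { total = total
  ; tails = λ i → bound i (Finₚ.any? (λ l → from? i l ×-dec ¬? (t l ℕₚ.≟ rajcodeᵈ w l)))
  }
  where
  open Attainable attainable
  open ℕₚ.≤-Reasoning
  bound : ∀ i → Dec (∃ λ l → i Fin.≤ l × t l ≢ rajcodeᵈ w l) → sum (t ↾ from? i) ≤ sum (v ↾ from? i)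
  bound i (no ¬∃) = begin
    sum (t ↾ from? i)            ≤⟨ sum-mono (↾-mono (from? i) λ {k} i≤k → ℕₚ.≮⇒≥ λ r<t →
      ¬∃ (k , i≤k , ≢-sym (ℕₚ.<⇒≢ r<t))) ⟩
    sum (rajcodeᵈ w ↾ from? i)   ≤⟨ raj-tail K i (λ ()) ⟩
    sum (v ↾ from? i) ∎
  bound i (yes (l , i≤l , t≢r)) = ℕₚ.+-cancelˡ-≤ (sum (v ↾ before? i)) _ _ (begin
    sum (v ↾ before? i) + sum (t ↾ from? i)
      ≤⟨ ℕₚ.+-monoˡ-≤ _ (dualWeight-head K i) ⟩
    sum (coinvcode w ↾ before? i) + sum (t ↾ from? i)
      ≤⟨ ℕₚ.+-monoˡ-≤ _ (sum-mono (↾-mono (before? i) λ k<i → ℕₚ.≮⇒≥ λ t<c →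
           t≢r (tight (ℕₚ.<-≤-trans k<i i≤l) t<c))) ⟩
    sum (t ↾ before? i) + sum (t ↾ from? i)
      ≡⟨ sum-before-from t i ⟨
    sum t
      ≡⟨ total ⟩
    sum v
      ≡⟨ sum-before-from v i ⟩
    sum (v ↾ before? i) + sum (v ↾ from? i) ∎)

complement-dominated : ∀ {u v : Vector ℕ n} → (∀ k → u k ≤ n ∸ suc (toℕ k)) → (∀ k → v k ≤ n ∸ suc (toℕ k)) →
                       Dominated u v → Dominated (complement v) (complement u)
complement-dominated {n} {u} {v} u≤ v≤ dominated = record
  { total = ℕₚ.+-cancelʳ-≡ (sum u) _ _ (begin
      sum (complement v) + sum u   ≡⟨ cong (sum (complement v) +_) total ⟩
      sum (complement v) + sum v   ≡⟨ ∑-distrib-+ (complement v) v ⟨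
      sum (complement v ⊕ v)       ≡⟨ sum-cong-≗ exact ⟩
      sum (complement u ⊕ u)       ≡⟨ ∑-distrib-+ (complement u) u ⟩
      sum (complement u) + sum u ∎)
  ; tails = λ i → ℕₚ.+-cancelʳ-≤ (sum (v ↾ from? i)) _ _ (ℕₚ.≤-trans
      (ℕₚ.≤-reflexive (trans (sym (sum-↾-⊕ i (complement v) v))
        (trans (sum-cong-≗ (λ k → cong (λ x → if does (from? i k) then x else 0) (exact k)))
          (sum-↾-⊕ i (complement u) u))))
      (ℕₚ.+-monoʳ-≤ _ (tails i)))
  }
  where
  open Dominated dominated
  open ≡-Reasoning
  exact : complement v ⊕ v ≗ complement u ⊕ u
  exact k = trans (ℕₚ.m∸n+n≡m (v≤ k)) (sym (ℕₚ.m∸n+n≡m (u≤ k)))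
  sum-↾-⊕ : ∀ i x y → sum ((x ⊕ y) ↾ from? i) ≡ sum (x ↾ from? i) + sum (y ↾ from? i)
  sum-↾-⊕ i x y = trans (sum-cong-≗ (↾-⊕ (from? i) x y)) (∑-distrib-+ (x ↾ from? i) _)

infixl 7 _·𝐞_

_·𝐞_ : ℕ → Fin n → Vector ℕ n
(e ·𝐞 i) k = e * 𝐞 i k

sum-·𝐞 : ∀ e (i : Fin n) → sum (e ·𝐞 i) ≡ e
sum-·𝐞 e i = trans (sum-cong-≗ scaled) (sum-point i e)
  where
  scaled : e ·𝐞 i ≗ const e ↾ (i ≟_)
  scaled k with does (i ≟ k)
  ... | true  = ℕₚ.*-identityʳ e
  ... | false = ℕₚ.*-zeroʳ e

-- These properties pass to vectors with a fixed first exponent (`cons-shiftOrder`), which allows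
-- induction on `n`.
record ShiftOrder {n} (_≲_ : Rel (Vector ℕ n) ℓ) : Set ℓ where
  field
    reflexive  : ∀ {u v} → u ≗ v → u ≲ v
    transitive : ∀ {u v t} → u ≲ v → v ≲ t → u ≲ t
    shift      : ∀ t {i j} → i < j → (t ⊕ 𝐞 i) ≲ (t ⊕ 𝐞 j)

  shifts : ∀ e t {i j} → i < j → (t ⊕ e ·𝐞 i) ≲ (t ⊕ e ·𝐞 j)
  shifts zero    t i<j = reflexive λ _ → refl
  shifts (suc e) t {i} {j} i<j = transitive (reflexive (λ k → split k i))
    (transitive (shift (t ⊕ e ·𝐞 i) i<j) (transitive (reflexive λ k → exchange k)
      (transitive (shifts e (t ⊕ 𝐞 j) i<j) (reflexive λ k → ℕₚ.+-assoc (t k) (𝐞 j k) _))))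
    where
    split : ∀ k i → t k + suc e * 𝐞 i k ≡ t k + e * 𝐞 i k + 𝐞 i k
    split k i = trans (cong (t k +_) (ℕₚ.+-comm (𝐞 i k) _)) (sym (ℕₚ.+-assoc (t k) _ _))
    exchange : ∀ k → t k + e * 𝐞 i k + 𝐞 j k ≡ t k + 𝐞 j k + e * 𝐞 i k
    exchange k = trans (ℕₚ.+-assoc (t k) _ _)
      (trans (cong (t k +_) (ℕₚ.+-comm (e * 𝐞 i k) _)) (sym (ℕₚ.+-assoc (t k) _ _)))

cons-shiftOrder : ∀ {_≲_ : Rel (Vector ℕ (suc n)) ℓ} → ShiftOrder _≲_ → ∀ c →
                  ShiftOrder (λ u v → (c Vector.∷ u) ≲ (c Vector.∷ v))
cons-shiftOrder {n} order c = record
  { reflexive  = λ u≗v → reflexive λ { zero → refl ; (suc k) → u≗v k }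
  ; transitive = transitive
  ; shift      = λ t i<j → transitive (reflexive λ k → sym (inner t k))
      (transitive (shift (c Vector.∷ t) (s≤s i<j)) (reflexive (inner t)))
  }
  where
  open ShiftOrder order
  inner : ∀ t {i : Fin n} → (c Vector.∷ t) ⊕ 𝐞 (suc i) ≗ c Vector.∷ (t ⊕ 𝐞 i)
  inner t zero    = ℕₚ.+-identityʳ c
  inner t (suc k) = refl

-- The excess of the first exponent is moved to the second one.

dominated⇒≲ : ∀ {n} {_≲_ : Rel (Vector ℕ n) ℓ} → ShiftOrder _≲_ → ∀ {u v} → Dominated u v → u ≲ v
dominated⇒≲ {n = zero} order _ = ShiftOrder.reflexive order λ ()
dominated⇒≲ {n = suc zero} order {u} {v} dominated = ShiftOrder.reflexive order
  λ { zero → ℕₚ.+-cancelʳ-≡ 0 _ _ (Dominated.total dominated) }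
dominated⇒≲ {n = suc (suc n)} {_≲_} order {u} {v} dominated =
  transitive (reflexive λ k → sym (merge k)) (transitive (shifts e (v zero Vector.∷ (u ∘ suc)) (s≤s z≤n))
    (transitive (reflexive moved)
      (transitive (dominated⇒≲ (cons-shiftOrder order (v zero)) rest)
        (reflexive (λ { zero → refl ; (suc k) → refl })))))
  where
  open ShiftOrder order
  open Dominated dominated
  v₀≤u₀ : v zero ≤ u zero
  v₀≤u₀ = ℕₚ.+-cancelʳ-≤ (sum (u ∘ suc)) _ _
    (ℕₚ.≤-trans (ℕₚ.+-monoʳ-≤ (v zero) (tails (suc zero))) (ℕₚ.≤-reflexive (sym total)))
  e : ℕ
  e = u zero ∸ v zero
  u′ : Vector ℕ (suc n)
  u′ = (u ∘ suc) ⊕ e ·𝐞 zero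
  merge : (v zero Vector.∷ (u ∘ suc)) ⊕ e ·𝐞 zero ≗ u
  merge zero    = trans (cong (v zero +_) (ℕₚ.*-identityʳ e)) (ℕₚ.m+[n∸m]≡n v₀≤u₀)
  merge (suc k) = trans (cong (u (suc k) +_) (ℕₚ.*-zeroʳ e)) (ℕₚ.+-identityʳ _)
  moved : (v zero Vector.∷ (u ∘ suc)) ⊕ e ·𝐞 suc zero ≗ v zero Vector.∷ u′
  moved zero    = trans (cong (v zero +_) (ℕₚ.*-zeroʳ e)) (ℕₚ.+-identityʳ _)
  moved (suc k) = refl
  u′-total : sum u′ ≡ sum (v ∘ suc)
  u′-total = ℕₚ.+-cancelˡ-≡ (v zero) _ _ (begin
    v zero + sum u′                            ≡⟨ sum-cong-≗ moved ⟨
    sum (v₀u ⊕ e ·𝐞 second)                    ≡⟨ ∑-distrib-+ v₀u (e ·𝐞 second) ⟩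
    sum v₀u + sum (e ·𝐞 second)                ≡⟨ cong (sum v₀u +_) (trans (sum-·𝐞 e second) (sym (sum-·𝐞 e first))) ⟩
    sum v₀u + sum (e ·𝐞 first)                 ≡⟨ ∑-distrib-+ v₀u (e ·𝐞 first) ⟨
    sum (v₀u ⊕ e ·𝐞 first)                     ≡⟨ sum-cong-≗ merge ⟩
    sum u                                      ≡⟨ total ⟩
    v zero + sum (v ∘ suc) ∎)
    where
    open ≡-Reasoning
    first second : Fin (suc (suc n))
    first  = zero
    second = suc zero
    v₀u : Vector ℕ (suc (suc n))
    v₀u = v zero Vector.∷ (u ∘ suc)
  rest : Dominated u′ (v ∘ suc)
  rest = record
    { total = u′-total
    ; tails = λ { zero    → ℕₚ.≤-reflexive u′-total
                ; (suc i) → ℕₚ.≤-trans (ℕₚ.≤-reflexive (sum-cong-≗ (λ k → unmoved i k))) (tails (suc (suc i))) }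
    }
    where
    unmoved : ∀ i → u′ ↾ from? (suc i) ≗ (u ∘ suc) ↾ from? (suc i)
    unmoved i zero    = refl
    unmoved i (suc k) = cong (λ x → if does (from? (suc i) (suc k)) then x else 0)
      (trans (cong (u (suc (suc k)) +_) (ℕₚ.*-zeroʳ e)) (ℕₚ.+-identityʳ _))

termOrder-shiftOrder : ∀ (T : TermOrder n ℓ) → let open TermOrder T in
                       (∀ {i j : Fin n} → i < j → 𝐞 i ≺ 𝐞 j) → ShiftOrder _≼_
termOrder-shiftOrder T increasing = record
  { reflexive  = reflexive
  ; transitive = ≼-trans
  ; shift      = λ t {i} {j} i<j → ≼-trans (reflexive λ k → ℕₚ.+-comm (t k) (𝐞 i k))
      (≼-trans (⊕-monoˡ t (proj₁ (increasing i<j))) (reflexive λ k → ℕₚ.+-comm (𝐞 j k) (t k)))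
  }
  where
  open TermOrder T
  open IsTotalOrder isTotalOrder using (reflexive) renaming (trans to ≼-trans)

-- Covers in the Bruhat order

coinv-cong : ∀ {u v : Permutation′ n} → u ≈ v → coinv u ≡ coinv v
coinv-cong {u = u} {v} u≈v = sum-cong-≗ λ k → #-cong (coinversion? u k) (coinversion? v k)
  (λ {l} (k<l , p) → k<l , subst₂ _<_ (u≈v k) (u≈v l) p)
  (λ {l} (k<l , p) → k<l , subst₂ _<_ (sym (u≈v k)) (sym (u≈v l)) p)

coinv-⟶ : ∀ {u v : Permutation′ n} → u ⟶ v → coinv v ℕ.< coinv u
coinv-⟶ {u = u} {v} (i , j , i<j , ui<uj , v≈) =
  ℕₚ.≤-<-trans (ℕₚ.≤-reflexive (coinv-cong {u = v} {swapAt u i j} v≈)) (coinv-< {w = u} (ascent i<j ui<uj))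

coinv-⟶⁺ : ∀ {u v : Permutation′ n} → TransClosure _⟶_ u v → coinv v ℕ.< coinv u
coinv-⟶⁺ {u = u} {v} [ u⟶v ] = coinv-⟶ {u = u} {v} u⟶v
coinv-⟶⁺ {u = u} {v} (_∷_ {y = x} u⟶x x⟶⁺v) = ℕₚ.<-trans (coinv-⟶⁺ {u = x} {v} x⟶⁺v) (coinv-⟶ {u = u} {x} u⟶x)

-- `coinv` serves as the corank in the Bruhat order.
coinv-<ᴮ : ∀ {u v : Permutation′ n} → u <ᴮ v → coinv v ℕ.< coinv u
coinv-<ᴮ (inj₁ u≈v , u≉v)  = contradiction u≈v u≉v
coinv-<ᴮ {u = u} {v} (inj₂ u⟶⁺v , _) = coinv-⟶⁺ {u = u} {v} u⟶⁺v

ascent⇒⟶ : ∀ {w : Permutation′ n} {i j} → Ascent w i j → w ⟶ swapAt w i j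
ascent⇒⟶ {i = i} {j} (ascent i<j wi<wj) = i , j , i<j , wi<wj , λ _ → refl

≉-at : ∀ {u v : Permutation′ n} i → val u i ≢ val v i → ¬ (u ≈ v)
≉-at i ui≢vi u≈v = ui≢vi (cong toℕ (u≈v i))

-- Along a cover `coinv` drops by exactly one, while a permutation strictly in between would require
-- two drops.
cover⇒⋖ : ∀ {w : Permutation′ n} {i j} → Cover w i j → w ⋖ swapAt w i j
cover⇒⋖ {w = w} {i} {j} i⋖j =
  (inj₂ [ ascent⇒⟶ {w = w} isAscent ] , ≉-at {u = w} {v = w′} i λ eq → ℕₚ.<⇒≢ wi<wj (trans eq (val-left w i j))) ,
  λ u (w<u , u<w′) → ℕₚ.<⇒≱ (coinv-<ᴮ {u = w} {u} w<u)
    (ℕₚ.≤-trans (ℕₚ.≤-reflexive (sym (coinv-cover i⋖j))) (coinv-<ᴮ {u = u} {w′} u<w′))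
  where
  open Cover i⋖j
  w′ = swapAt w i j

-- A position `k` violating the local criterion makes `swapAt w i k` a permutation strictly between
-- `w` and `swapAt w i j`.
⋖⇒cover : ∀ {w : Permutation′ n} {i j} → i < j → w ⋖ swapAt w i j → Cover w i j
⋖⇒cover {w = w} {i} {j} i<j (w<w′ , nothing-between) = cover i↗j λ {k} i<k k<j wi<wk wk<wj →
  nothing-between (swapAt w i k) (below i<k k<j wi<wk wk<wj)
  where
  w′ = swapAt w i j
  swap-back : swapAt w′ i j ≈ w
  swap-back k with position i j k
  ... | left  = Finₚ.toℕ-injective (trans (val-left w′ i j) (val-right w i j))
  ... | right = Finₚ.toℕ-injective (trans (val-right w′ i j) (val-left w i j))
  ... | other k≢i k≢j = Finₚ.toℕ-injective (trans (val-other w′ i j k≢i k≢j) (val-other w i j k≢i k≢j))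
  i↗j : Ascent w i j
  i↗j with val-<⊎> w (<⇒≢ i<j)
  ... | inj₁ wi<wj = ascent i<j wi<wj
  -- If `w(j) < w(i)`, then `w` arises from `w′` by an ascent, so `coinv` would be larger at `w′`,
  -- against `w <ᴮ w′`.
  ... | inj₂ wj<wi = contradiction (coinv-<ᴮ {u = w} {w′} w<w′) (ℕₚ.<-asym
    (ℕₚ.≤-<-trans (ℕₚ.≤-reflexive (sym (coinv-cong {u = swapAt w′ i j} {w} swap-back))) (coinv-< {w = w′}
      (ascent i<j (subst₂ ℕ._<_ (sym (val-left w i j)) (sym (val-right w i j)) wj<wi)))))
  -- w t_{ij} = w t_{ik} t_{kj} t_{ik}, where each factor is an ascent.
  below : ∀ {k} → i < k → k < j → val w i ℕ.< val w k → val w k ℕ.< val w j →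
          w <ᴮ swapAt w i k × swapAt w i k <ᴮ w′
  below {k} i<k k<j wi<wk wk<wj =
    (inj₂ [ ascent⇒⟶ {w = w} (ascent i<k wi<wk) ] , ≉-at {u = w} {v = u} i λ eq → ℕₚ.<⇒≢ wi<wk (trans eq ui)) ,
    (inj₂ (_∷_ {y = x} (ascent⇒⟶ {w = u} (ascent k<j (subst₂ ℕ._<_ (sym uk) (sym uj) (Ascent.wi<wj i↗j))))
             [ (i , k , i<k , subst₂ ℕ._<_ (sym xi) (sym xk) wk<wj , w′≈) ]) ,
     ≉-at {u = u} {v = w′} i λ eq → ℕₚ.<⇒≢ wk<wj (trans (sym ui) (trans eq (val-left w i j))))
    where
    u = swapAt w i k
    x = swapAt u k j
    ui : val u i ≡ val w k
    ui = val-left w i k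
    uk : val u k ≡ val w i
    uk = val-right w i k
    uj : val u j ≡ val w j
    uj = val-other w i k (>⇒≢ i<j) (>⇒≢ k<j)
    xi : val x i ≡ val w k
    xi = trans (val-other u k j (<⇒≢ i<k) (<⇒≢ i<j)) ui
    xk : val x k ≡ val w j
    xk = trans (val-left u k j) uj
    xj : val x j ≡ val w i
    xj = trans (val-right u k j) uk
    w′≈ : w′ ≈ swapAt x i k
    w′≈ l = Finₚ.toℕ-injective (at (position i k l) (l ≟ j))
      where
      at : ∀ {l} → Position i k l → Dec (l ≡ j) → val w′ l ≡ val (swapAt x i k) l
      at left  _ = trans (val-left w i j) (sym (trans (val-left x i k) xk))
      at right _ = trans (val-other w i j (>⇒≢ i<k) (<⇒≢ k<j)) (sym (trans (val-right x i k) xi))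
      at (other _ _) (yes refl) =
        trans (val-right w i j) (sym (trans (val-other x i k (>⇒≢ i<j) (>⇒≢ k<j)) xj))
      at (other l≢i l≢k) (no l≢j) = trans (val-other w i j l≢i l≢j) (sym (trans (val-other x i k l≢i l≢k)
        (trans (val-other u k j l≢k l≢j) (val-other w i k l≢i l≢k))))

#-before : ∀ (k : Fin n) → #[ before? k ] ≡ toℕ k
#-before k = trans (#-sum (before? k)) (go k)
  where
  go : ∀ {n} (k : Fin n) → sum (const 1 ↾ before? k) ≡ toℕ k
  go {suc n} zero    = sum-replicate-zero n
  go {suc n} (suc k) = cong suc (go k)

-- `w(k)` is the number of positions with smaller values, and in a decreasing permutation these are
-- the positions after `k`.
descends⇒reverse : ∀ {w : Permutation′ n} → (∀ {k l} → k < l → val w l ℕ.< val w k) → w ≈ reverse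
descends⇒reverse {n} {w} desc k = Finₚ.toℕ-injective (begin
  val w k                                 ≡⟨ #-before (w ⟨$⟩ʳ k) ⟨
  #[ before? (w ⟨$⟩ʳ k) ]                 ≡⟨ #-permute (before? (w ⟨$⟩ʳ k)) w ⟩
  #[ (before? (w ⟨$⟩ʳ k) ∘ (w ⟨$⟩ʳ_)) ]   ≡⟨ #-cong (before? (w ⟨$⟩ʳ k) ∘ (w ⟨$⟩ʳ_)) (later? k) after desc ⟩
  #[ later? k ]                           ≡⟨ #-later k ⟩
  n ∸ suc (toℕ k)                         ≡⟨ Finₚ.opposite-prop k ⟨
  toℕ (opposite k) ∎)
  where
  open ≡-Reasoning
  after : ∀ {l} → val w l ℕ.< val w k → k < l
  after {l} wl<wk with Finₚ.<-cmp k l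
  ... | tri< k<l _ _  = k<l
  ... | tri≈ _ refl _ = contradiction wl<wk (ℕₚ.<-irrefl refl)
  ... | tri> _ _ l<k  = contradiction (desc l<k) (ℕₚ.<-asym wl<wk)

reverse⇒descends : ∀ {w : Permutation′ n} → w ≈ reverse → ∀ {k l} → k < l → val w l ℕ.< val w k
reverse⇒descends {n} w≈ {k} {l} k<l = subst₂ ℕ._<_
  (sym (trans (cong toℕ (w≈ l)) (Finₚ.opposite-prop l)))
  (sym (trans (cong toℕ (w≈ k)) (Finₚ.opposite-prop k)))
  (ℕₚ.∸-monoʳ-< (s≤s k<l) (Finₚ.toℕ<n l))

-- Marked climbing chains as lists

-- The formula of `dualWeight` for a bare list with an index set, which permits recursion on the
-- list.
dualCount : (C : List (Link n)) → Subset (length C) → Vector ℕ n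
dualCount C U k = #[ (λ p → p ∈? U ×-dec proj₁ (lookup C p) ≟ k) ]

private
  counted? : ∀ (C : List (Link n)) (U : Subset (length C)) k → Decidable (λ p → p ∈ˢ U × proj₁ (lookup C p) ≡ k)
  counted? C U k p = p ∈? U ×-dec proj₁ (lookup C p) ≟ k

-- As a sum over `Fin (suc _)`, the count splits off its first index, whose summand computes to
-- `𝐞 i k`.
dualCount-inside : ∀ i j (C : List (Link n)) U → dualCount ((i , j) ∷ C) (inside Vec.∷ U) ≗ dualCount C U ⊕ 𝐞 i
dualCount-inside i j C U k = trans (#-sum (counted? ((i , j) ∷ C) (inside Vec.∷ U) k))
  (trans (cong (𝐞 i k +_) (sym (#-sum (counted? C U k)))) (ℕₚ.+-comm (𝐞 i k) _))

dualCount-outside : ∀ c (C : List (Link n)) U → dualCount (c ∷ C) (outside Vec.∷ U) ≗ dualCount C U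
dualCount-outside c C U k =
  trans (#-sum (counted? (c ∷ C) (outside Vec.∷ U) k)) (sym (#-sum (counted? C U k)))

sum-dualCount : ∀ (C : List (Link n)) U → sum (dualCount C U) ≡ ∣ U ∣
sum-dualCount {n} [] Vec.[] = sum-replicate-zero n
sum-dualCount ((i , j) ∷ C) (true Vec.∷ U) =
  trans (sum-⊕-𝐞 i (dualCount-inside i j C U)) (cong suc (sum-dualCount C U))
sum-dualCount (c ∷ C) (false Vec.∷ U) =
  trans (sum-cong-≗ (dualCount-outside c C U)) (sum-dualCount C U)

-- Each link lowers `coinv` by one, down to zero at the top. So all climbing chains of `w` have the
-- same length, and the condition on the number of marks fixes the total of the dual weight.
length-coinv : ∀ {w : Permutation′ n} C → All (uncurry′ _<_) C → w ▷ C ≈ reverse → Saturated w C → length C ≡ coinv w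
length-coinv {n} {w} [] _ end _ = sym (sum-zero {n} λ k →
  coinvcode-zero⁻ w (reverse⇒descends {w = w} end {k}))
length-coinv {w = w} ((i , j) ∷ C) (i<j ∷ ordered) end (w⋖ , saturated) =
  trans (cong suc (length-coinv {w = swapAt w i j} C ordered end saturated)) (coinv-cover (⋖⇒cover {w = w} i<j w⋖))

chainLength-coinv : ∀ {w : Permutation′ n} (K : MarkedClimbingChain w) → MarkedClimbingChain.chainLength K ≡ coinv w
chainLength-coinv {w = w} K = length-coinv {w = w} links ordered endsAtTop saturated
  where
  open MarkedClimbingChain K
  open IsClimbingChain isClimbingChain

-- The conditions on the rest of a chain refer to the link before it; carrying that link as a
-- parameter, with `nothing` at the beginning, allows recursion on the list.
MonotoneFrom : Maybe (Link n) → List (Link n) → Set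
MonotoneFrom nothing  C = Linked (λ c c′ → proj₁ c Fin.≤ proj₁ c′) C
MonotoneFrom (just c) C = Linked (λ c c′ → proj₁ c Fin.≤ proj₁ c′) (c ∷ C)

minimalFrom : Maybe (Link n) → (C : List (Link n)) → Subset (length C)
minimalFrom nothing  C = minimalMarkings C
minimalFrom (just c) C = minimalAfter c C

MonotoneFrom-head : ∀ p {c : Link n} {C} → MonotoneFrom p (c ∷ C) → p ⊑ proj₁ c
MonotoneFrom-head nothing  _       = tt
MonotoneFrom-head (just _) (r ∷ _) = r

MonotoneFrom-tail : ∀ p {c : Link n} {C} → MonotoneFrom p (c ∷ C) → MonotoneFrom (just c) C
MonotoneFrom-tail nothing  l       = l
MonotoneFrom-tail (just _) (_ ∷ l) = l

MonotoneFrom-cons : ∀ p {c : Link n} {C} → p ⊑ proj₁ c → MonotoneFrom (just c) C → MonotoneFrom p (c ∷ C)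
MonotoneFrom-cons nothing  _ l = l
MonotoneFrom-cons (just _) r l = r ∷ l

minimalFrom-tail : ∀ p {c : Link n} {C s U} → minimalFrom p (c ∷ C) ⊆ s Vec.∷ U → minimalAfter c C ⊆ U
minimalFrom-tail nothing  = drop-∷-⊆
minimalFrom-tail (just _) = drop-∷-⊆

-- An unmarked link is not minimal, so it neither opens a row nor moves right within one;
-- monotonicity leaves a weak move left in the same row. The first link is always minimal.
unmarked-same-row : ∀ p {i j : Fin n} {C U} → p ⊑ i → minimalFrom p ((i , j) ∷ C) ⊆ outside Vec.∷ U →
                    ∃ λ j₀ → p ≡ just (i , j₀) × j Fin.≤ j₀
unmarked-same-row nothing _ minimal⊆ = contradiction (minimal⊆ here) λ ()
unmarked-same-row (just (i₀ , j₀)) {i} {j} {C} {U} i₀≤i minimal⊆ = decide (i₀ <? i) (i₀ ≟ i) (j₀ <? j)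
  where
  minimal? = i₀ <? i ⊎-dec (i₀ ≟ i ×-dec j₀ <? j)
  ¬minimal : ¬ (i₀ < i ⊎ (i₀ ≡ i × j₀ < j))
  ¬minimal m = contradiction
    (minimal⊆ (subst (λ s → zero ∈ˢ s Vec.∷ minimalAfter (i , j) C) (sym (dec-true minimal? m)) here)) λ ()
  decide : Dec (i₀ < i) → Dec (i₀ ≡ i) → Dec (j₀ < j) → ∃ λ j₁ → just (i₀ , j₀) ≡ just (i , j₁) × j Fin.≤ j₁
  decide (yes i₀<i) _          _          = contradiction (inj₁ i₀<i) ¬minimal
  decide (no i₀≮i)  (no i₀≢i)  _          = contradiction (Finₚ.≤∧≢⇒< i₀≤i i₀≢i) i₀≮i
  decide (no _)     (yes refl) (yes j₀<j) = contradiction (inj₂ (refl , j₀<j)) ¬minimal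
  decide (no _)     (yes refl) (no j₀≮j)  = j₀ , refl , ℕₚ.≮⇒≥ j₀≮j

MarkedChain-resp : ∀ {w : Permutation′ n} {p t t′} → t ≗ t′ → MarkedChain w p t → MarkedChain w p t′
MarkedChain-resp t≗t′ (top desc t≗0)  = top desc λ k → trans (sym (t≗t′ k)) (t≗0 k)
MarkedChain-resp t≗t′ (mark r c K t≗) = mark r c K λ k → trans (sym (t≗t′ k)) (t≗ k)
MarkedChain-resp t≗t′ (skip j≤ c K)   = skip j≤ c (MarkedChain-resp t≗t′ K)

fromLinks : ∀ {w : Permutation′ n} p C U → All (uncurry′ _<_) C → MonotoneFrom p C → w ▷ C ≈ reverse →
            Saturated w C → minimalFrom p C ⊆ U → MarkedChain w p (dualCount C U)
fromLinks {w = w} p [] Vec.[] _ _ end _ _ = top (reverse⇒descends {w = w} end) λ _ → refl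
fromLinks {w = w} p ((i , j) ∷ C) (true Vec.∷ U) (i<j ∷ ordered) monotone end (w⋖ , saturated) minimal⊆ =
  mark (MonotoneFrom-head p monotone) (⋖⇒cover {w = w} i<j w⋖)
    (fromLinks (just (i , j)) C U ordered (MonotoneFrom-tail p monotone) end saturated
      (minimalFrom-tail p minimal⊆))
    (dualCount-inside i j C U)
fromLinks {w = w} p ((i , j) ∷ C) (false Vec.∷ U) (i<j ∷ ordered) monotone end (w⋖ , saturated) minimal⊆
  with unmarked-same-row p (MonotoneFrom-head p monotone) minimal⊆
... | j₀ , refl , j≤j₀ = MarkedChain-resp (λ k → sym (dualCount-outside (i , j) C U k))
  (skip j≤j₀ (⋖⇒cover {w = w} i<j w⋖)
    (fromLinks (just (i , j)) C U ordered (MonotoneFrom-tail p monotone) end saturated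
      (minimalFrom-tail p {s = false} minimal⊆)))

fromMarkedClimbingChain : ∀ {w : Permutation′ n} (K : MarkedClimbingChain w) →
                          MarkedChain w nothing (MarkedClimbingChain.dualWeight K)
fromMarkedClimbingChain {w = w} K =
  fromLinks {w = w} nothing links marks ordered monotone endsAtTop saturated minimal⊆marks
  where
  open MarkedClimbingChain K
  open IsClimbingChain isClimbingChain

record LinksFrom {n} (p : Maybe (Link n)) (w : Permutation′ n) (t : Vector ℕ n) : Set where
  field
    links     : List (Link n)
    marks     : Subset (length links)
    ordered   : All (uncurry′ _<_) links
    monotone  : MonotoneFrom p links
    endsAtTop : w ▷ links ≈ reverse
    saturated : Saturated w links
    minimal⊆  : minimalFrom p links ⊆ marks
    weight    : dualCount links marks ≗ t

∷-⊆ : ∀ {s s′} {U V : Subset n} → (zero ∈ˢ s Vec.∷ U → zero ∈ˢ s′ Vec.∷ V) → U ⊆ V → s Vec.∷ U ⊆ s′ Vec.∷ V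
∷-⊆ head⊆ _   {zero}  z∈         = head⊆ z∈
∷-⊆ _ tail⊆ {suc _} (there x∈) = there (tail⊆ x∈)

toLinks : ∀ {w : Permutation′ n} {p t} → MarkedChain w p t → LinksFrom p w t
toLinks {w = w} {p} (top desc t≗0) = record
  { links     = []
  ; marks     = Vec.[]
  ; ordered   = []
  ; monotone  = monotone[] p
  ; endsAtTop = descends⇒reverse {w = w} desc
  ; saturated = tt
  ; minimal⊆  = λ {}
  ; weight    = λ k → sym (t≗0 k)
  }
  where
  monotone[] : ∀ p → MonotoneFrom p []
  monotone[] nothing  = []
  monotone[] (just _) = [-]
toLinks {w = w} {p} (mark {i = i} {j} p⊑i c K t≗) = record
  { links     = (i , j) ∷ links
  ; marks     = inside Vec.∷ marks
  ; ordered   = Cover.i<j c ∷ ordered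
  ; monotone  = MonotoneFrom-cons p p⊑i monotone
  ; endsAtTop = endsAtTop
  ; saturated = cover⇒⋖ c , saturated
  ; minimal⊆  = minimal⊆′ p
  ; weight    = λ k → trans (dualCount-inside i j links marks k) (trans (cong (_+ 𝐞 i k) (weight k)) (sym (t≗ k)))
  }
  where
  open LinksFrom (toLinks K)
  minimal⊆′ : ∀ p → minimalFrom p ((i , j) ∷ links) ⊆ inside Vec.∷ marks
  minimal⊆′ nothing  = ∷-⊆ (λ _ → here) minimal⊆
  minimal⊆′ (just _) = ∷-⊆ (λ _ → here) minimal⊆
toLinks {w = w} (skip {i = i} {j} {j′} j′≤j c K) = record
  { links     = (i , j′) ∷ links
  ; marks     = outside Vec.∷ marks
  ; ordered   = Cover.i<j c ∷ ordered
  ; monotone  = ℕₚ.≤-refl ∷ monotone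
  ; endsAtTop = endsAtTop
  ; saturated = cover⇒⋖ c , saturated
  -- A weak move left within row `i` is not minimal, so the minimal set has `false` at its head.
  ; minimal⊆  = ∷-⊆ (subst (λ s → zero ∈ˢ s Vec.∷ minimalAfter (i , j′) links → zero ∈ˢ outside Vec.∷ marks)
                      (sym (dec-false minimal? ¬minimal)) λ ()) minimal⊆
  ; weight    = λ k → trans (dualCount-outside (i , j′) links marks k) (weight k)
  }
  where
  open LinksFrom (toLinks K)
  minimal? = i <? i ⊎-dec (i ≟ i ×-dec j <? j′)
  ¬minimal : ¬ (i < i ⊎ (i ≡ i × j < j′))
  ¬minimal (inj₁ i<i)        = ℕₚ.<-irrefl refl i<i
  ¬minimal (inj₂ (_ , j<j′)) = ℕₚ.<⇒≱ j<j′ j′≤j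

toMarkedClimbingChain : ∀ {w : Permutation′ n} {t} → MarkedChain w nothing t →
                        ∃ λ (K : MarkedClimbingChain w) → MarkedClimbingChain.dualWeight K ≗ t
toMarkedClimbingChain K = record
  { links           = links
  ; isClimbingChain = record
    { ordered = ordered ; monotone = monotone ; endsAtTop = endsAtTop ; saturated = saturated }
  ; marks           = marks
  ; minimal⊆marks   = minimal⊆
  } , weight
  where open LinksFrom (toLinks K)

-- Extremal weights and dual weights

theorem10p3 : ∀ {ℓ : Level} {n : ℕ} (w : Permutation′ n) (T : TermOrder n ℓ) →
    let open TermOrder T in
    (∀ {i j : Fin n} → i < j → 𝐞 i ≺ 𝐞 j) →
    ∀ (d : ℕ) → 1 ≤ d → d ≤ raj w ∸ inv w →
    IsMinimum _≼_ (DualWeights w d) (Lᵈ w d) × IsMaximum _≼_ (Weights w d) (L w d)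
theorem10p3 {ℓ} {n} w T increasing d _ d≤D =
  -- One marked chain attains both extremes, since `weight` is the complement of `dualWeight`.
  ((K₀ , marks₀ , K₀-weight) , minimum) , ((K₀ , marks₀ , K₀-weight′) , maximum)
  where
  open TermOrder T
  open MarkedClimbingChain
  order : ShiftOrder _≼_
  order = termOrder-shiftOrder T increasing
  open ShiftOrder order
  filling = L-filling w d d≤D
  t = Lᵈ w d
  attainable : Attainable w t
  attainable = filling-attainable filling
  -- The bound on the length has to exceed `coinv w`; with no preceding link, any row may come
  -- first.
  built = toMarkedClimbingChain (attain (suc (coinv w)) w ℕₚ.≤-refl (λ _ → tt) attainable)
  K₀ = proj₁ built
  K₀-weight : dualWeight K₀ ≗ t
  K₀-weight = proj₂ built
  L≗ : complement t ≗ L w d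
  L≗ k = ℕₚ.m∸[m∸n]≡n (filling-≤ filling k)
  K₀-weight′ : weight K₀ ≗ L w d
  K₀-weight′ k = trans (cong (n ∸ suc (toℕ k) ∸_) (K₀-weight k)) (L≗ k)
  sum-dualWeight : ∀ (K : MarkedClimbingChain w) → sum (dualWeight K) ≡ #marks K
  sum-dualWeight K = sum-dualCount (links K) (marks K)
  marks₀ : #marks K₀ + d ≡ chainLength K₀
  marks₀ = trans (cong (_+ d) (trans (sym (sum-dualWeight K₀)) (sum-cong-≗ K₀-weight)))
    (trans (filling-total filling) (sym (chainLength-coinv K₀)))
  dominated : ∀ K → #marks K + d ≡ chainLength K → Dominated t (dualWeight K)
  -- Adding `d` to either total gives `coinv w`: for `t` by `filling-total`, for `K` because its
  -- length is `coinv w`.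
  dominated K marks≡ = attainable-dominated attainable (fromMarkedClimbingChain K)
    (ℕₚ.+-cancelʳ-≡ d _ _ (trans (filling-total filling)
      (trans (sym (chainLength-coinv K)) (trans (sym marks≡) (cong (_+ d) (sym (sum-dualWeight K)))))))
  minimum : ∀ v → DualWeights w d v → t ≼ v
  minimum v (K , marks≡ , weight≗) = transitive (dominated⇒≲ order (dominated K marks≡)) (reflexive weight≗)
  maximum : ∀ v → Weights w d v → v ≼ L w d
  maximum v (K , marks≡ , weight≗) = transitive (reflexive λ k → sym (weight≗ k))
    (transitive (dominated⇒≲ order (complement-dominated (λ k → ℕₚ.m∸n≤m _ (L w d k))
      (dualWeight-≤ (fromMarkedClimbingChain K)) (dominated K marks≡)))
      (reflexive L≗))
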